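{- Let $G$ be a graph of order $n$ and let $k$ be an integer with $1\leq 2k\leq \delta(G)$. Then $\gamma_{\times 2k,t}(G_I)=2kn$ if and only if $G$ is a $k$-Hamiltonian-like decomposable graph.
   Context: All graphs are finite, simple and undirected. For a graph $G$ without isolated vertices, the inflated graph $G_I$ is obtained as follows: each vertex $x_i$ of $G$ of degree $d(x_i)$ is replaced by a clique $X_i\cong K_{d(x_i)}$ whose vertices are labelled $x_ix_j$, one for each neighbour $x_j$ of $x_i$; and each edge $x_ix_j$ of $G$ is replaced by the edge joining $x_ix_j\in X_i$ to $x_jx_i\in X_j$. For an integer $k\geq1$, a set $S\subseteq V(H)$ is a $k$-tuple total dominating set of a graph $H$ if every vertex of $H$ has at least $k$ neighbours in $S$; $\gamma_{\times k,t}(H)$ denotes the minimum cardinality of such a set. A subgraph of $G$ is Hamiltonian if it contains a cycle through all of its vertices (a Hamiltonian cycle). A Hamiltonian-like decomposition of $G$ is a family of pairwise vertex-disjoint Hamiltonian subgraphs $G_1,\dots,G_t$ of $G$ with $V(G)=V(G_1)\cup\dots\cup V(G_t)$. For an integer $k\geq 1$, $G$ is a $k$-Hamiltonian-like decomposable graph (kHLD-graph) if there are $k$ Hamiltonian-like decompositions $G_1^{(i)},\dots,G_{t_i}^{(i)}$ ($1\leq i\leq k$) of $G$, together with a Hamiltonian cycle $C_s^{(i)}$ of each $G_s^{(i)}$, such that for any two distinct Hamiltonian subgraphs $G_s^{(i)}$ and $G_r^{(j)}$ in these decompositions the cycles $C_s^{(i)}$ and $C_r^{(j)}$ are disjoint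 (share no edge). -}

module Defs where

open import Data.Bool using (Bool; true; false; _∧_; _∨_; not; if_then_else_)
open import Data.Fin using (Fin; _≟_)
open import Data.Nat using (ℕ; zero; suc; _+_; _*_; _≤_)
open import Data.Nat.ListAction using (sum)
open import Data.List using (List; []; _∷_; length; map; zip; _++_; [_]; allFin)
open import Data.List.Membership.Propositional using (_∈_)
open import Data.List.Relation.Unary.Unique.Propositional using (Unique)
open import Data.Product using (Σ; ∃; _×_; _,_)
open import Data.Sum using (_⊎_)
open import Data.Empty using (⊥)
open import Relation.Binary.PropositionalEquality using (_≡_; _≢_)
open import Relation.Nullary.Decidable using (⌊_⌋)

record Graph (n : ℕ) : Set where
  field
    adj    : Fin n → Fin n → Bool
    sym    : ∀ i j → adj i j ≡ adj j i
    irrefl : ∀ i → adj i i ≡ false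

module _ {n : ℕ} where

  Edge : Graph n → Fin n → Fin n → Set
  Edge G i j = Graph.adj G i j ≡ true

  b2n : Bool → ℕ
  b2n true  = 1
  b2n false = 0

  count : (Fin n → Bool) → ℕ
  count p = sum (map (λ i → b2n (p i)) (allFin n))

  count₂ : (Fin n → Fin n → Bool) → ℕ
  count₂ p = sum (map (λ i → count (p i)) (allFin n))

  degree : Graph n → Fin n → ℕ
  degree G v = count (Graph.adj G v)

  -- The inflated graph G_I.
  -- Vertices of G_I: the ordered pairs (i , j) with x_i x_j ∈ E(G)
  -- (vertex x_i x_j of the clique X_i).
  -- Adjacency in G_I between arcs (i , j) and (i' , j'):
  --   same clique (i = i', j ≠ j')  or  the edge-copy (i = j', j = i').

  IVertex : Graph n → Fin n → Fin n → Bool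
  IVertex G i j = Graph.adj G i j

  IAdj : Fin n → Fin n → Fin n → Fin n → Bool
  IAdj i j i' j' = (⌊ i ≟ i' ⌋ ∧ not ⌊ j ≟ j' ⌋) ∨ (⌊ i ≟ j' ⌋ ∧ ⌊ j ≟ i' ⌋)

  -- A subset S of V(G_I) is given by a Boolean predicate on pairs;
  -- only pairs that are vertices of G_I count as members.
  ISubset : Set
  ISubset = Fin n → Fin n → Bool

  Icard : Graph n → ISubset → ℕ
  Icard G S = count₂ (λ i j → IVertex G i j ∧ S i j)

  Inbrs : Graph n → ISubset → Fin n → Fin n → ℕ
  Inbrs G S i j = count₂ (λ i' j' → IVertex G i' j' ∧ S i' j' ∧ IAdj i j i' j')

  IsKTupleTDS-I : Graph n → ℕ → ISubset → Set
  IsKTupleTDS-I G k S = ∀ i j → Edge G i j → k ≤ Inbrs G S i j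

  γ×t-Inflated≡ : Graph n → ℕ → ℕ → Set
  γ×t-Inflated≡ G k m =
    (Σ ISubset λ S → IsKTupleTDS-I G k S × Icard G S ≡ m)
    × (∀ S → IsKTupleTDS-I G k S → m ≤ Icard G S)

  cycPairs : List (Fin n) → List (Fin n × Fin n)
  cycPairs []       = []
  cycPairs (x ∷ xs) = zip (x ∷ xs) (xs ++ [ x ])

  CycEdge : List (Fin n) → Fin n → Fin n → Set
  CycEdge c u v = ((u , v) ∈ cycPairs c) ⊎ ((v , u) ∈ cycPairs c)

  -- A Hamiltonian subgraph H of G together with a chosen Hamiltonian
  -- cycle C of H.  V(H) = the vertices listed in cyc; E(H) = E.
  record HamSub (G : Graph n) : Set where
    field
      cyc        : List (Fin n)
      E          : Fin n → Fin n → Bool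
      E-sym      : ∀ i j → E i j ≡ E j i
      E⊆G        : ∀ i j → E i j ≡ true → Edge G i j
      E-ends     : ∀ i j → E i j ≡ true → i ∈ cyc
      cyc-unique : Unique cyc
      cyc-len    : 3 ≤ length cyc
      cyc-edges  : ∀ u v → CycEdge cyc u v → E u v ≡ true

  record HLD (G : Graph n) : Set where
    field
      t        : ℕ
      part     : Fin t → HamSub G
      disjoint : ∀ s r → s ≢ r → ∀ v →
                 v ∈ HamSub.cyc (part s) → v ∈ HamSub.cyc (part r) → ⊥
      cover    : ∀ v → ∃ λ s → v ∈ HamSub.cyc (part s)

  HIdx : (G : Graph n) (k : ℕ) → (Fin k → HLD G) → Set
  HIdx G k D = Σ (Fin k) λ i → Fin (HLD.t (D i))

  cycOf : (G : Graph n) (k : ℕ) (D : Fin k → HLD G) → HIdx G k D → List (Fin n)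
  cycOf G k D (i , s) = HamSub.cyc (HLD.part (D i) s)

  kHLD : Graph n → ℕ → Set
  kHLD G k =
    Σ (Fin k → HLD G) λ D →
      ∀ (a b : HIdx G k D) → a ≢ b →
        ∀ u v → CycEdge (cycOf G k D a) u v → CycEdge (cycOf G k D b) u v → ⊥

{-# OPTIONS --safe #-}

-- Let s_i be the number of members of S in the clique X_i. Counting neighbours of x_i x_j gives
-- s_i - [x_i x_j ∈ S] + [x_j x_i ∈ S], so a 2k-tuple total dominating set has s_i ≥ 2k for every i, and
-- in case of equality x_i x_j ∈ S forces x_j x_i ∈ S. Hence γ = 2kn says exactly that G has a spanning
-- 2k-regular subgraph. The cycles of a kHLD form such a subgraph. The converse is Petersen's
-- 2-factor theorem: orient the subgraph with in- and outdegrees k, decompose the resulting k-regular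
-- bipartite multigraph into k permutations, and take the orbits of each permutation as its cycles;
-- since no edge is used twice, the orbits have length at least 3.

module Submission where

open import Defs
open import Data.Bool using (Bool; true; false; _∧_; _∨_; not)
open import Data.Bool.Properties using (∧-comm; ∧-assoc; ∧-zeroʳ; ∧-conicalˡ; ∧-conicalʳ)
open import Data.Empty using (⊥; ⊥-elim)
open import Data.Fin using (Fin; zero; suc; _≟_; toℕ)
import Data.Fin as Fin
open import Data.Fin.Permutation using (Permutation′; permutation; _⟨$⟩ʳ_; _⟨$⟩ˡ_; inverseˡ; inverseʳ)
open import Data.Fin.Properties using (pigeonhole; <-cmp)
open import Data.List using (List; []; _∷_; _++_; [_]; length; map; concatMap; replicate; allFin; zip; iterate; lookup)
open import Data.List.Membership.Propositional using (_∈_)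
open import Data.List.Membership.Propositional.Properties using (∈-allFin; ∈-map⁺; ∈-lookup; ∈-∃++)
open import Data.List.Properties using (++-assoc; ++-identityʳ; length-iterate; length-tabulate; map-∘; map-tabulate)
open import Data.List.Relation.Binary.Permutation.Propositional as ↭ using (_↭_; refl; prep; swap; ↭-sym; ↭-reflexive)
open import Data.List.Relation.Binary.Permutation.Propositional.Properties using (shift; ↭-length; ∈-resp-↭; ++-comm)
open import Data.List.Relation.Binary.Pointwise using (Pointwise; []; _∷_)
open import Data.List.Relation.Unary.All as All using (All; []; _∷_)
open import Data.List.Relation.Unary.All.Properties using (¬Any⇒All¬)
open import Data.List.Relation.Unary.AllPairs using (AllPairs; []; _∷_)
open import Data.List.Relation.Unary.Any as Any using (Any; here; there)
open import Data.List.Relation.Unary.Any.Properties using (lookup-index)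
open import Data.List.Relation.Unary.Unique.Propositional using (Unique)
open import Data.List.Relation.Unary.Unique.Propositional.Properties using (allFin⁺)
open import Data.Nat using (ℕ; zero; suc; _+_; _*_; _∸_; _^_; _≤_; _<_; z≤n; s≤s; NonZero)
import Data.Nat as ℕ
open import Data.Nat.DivMod using (_/_; _%_; m≡m%n+[m/n]*n; m%n<n)
open import Data.Nat.Divisibility using (_∣_; divides; ∣m+n∣m⇒∣n; m∣m*n)
import Data.Nat.GeneralisedArithmetic as ℕ using (iterate)
open import Data.Nat.ListAction using (sum)
open import Data.Nat.Properties hiding (_≟_; <-cmp)
open import Data.Nat.Tactic.RingSolver using (solve-∀)
open import Data.Product as × using (∃; ∃₂; _×_; _,_; proj₁; proj₂)
open import Data.Sum as ⊎ using (_⊎_; inj₁; inj₂)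
open import Data.Sum.Properties using (≡-dec)
open import Function using (_∘_; id)
open import Function.Bundles using (_⇔_; mk⇔)
open import Relation.Binary.Definitions using (tri<; tri≈; tri>; DecidableEquality)
open import Relation.Binary.PropositionalEquality using (_≡_; _≢_; refl; sym; trans; cong; cong₂; subst; subst₂; module ≡-Reasoning)
open import Relation.Nullary using (¬_; Dec; yes; no; does)
open import Relation.Nullary.Decidable using (dec-true; isYes≗does)
open import Relation.Unary using (Decidable)

-- Eulerian orientations are used for two purposes: one orients the 2k-regular subgraph, and others
-- halve a bipartite multigraph repeatedly, which takes the place of Hall's theorem in the search
-- for perfect matchings. They are therefore constructed for arbitrary edge lists over any vertex
-- type with decidable equality: splicing two edges into one can create loops and parallel edges
-- even from a simple graph, and the multigraphs to be halved may have repeated edges from the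
-- outset. The decomposition into permutations has to be exact, with multiplicities, and not merely
-- supported on the subgraph. Only then does the fact that each edge receives one direction pass to
-- the permutations together, where it both excludes 2-cycles and separates the edges of different
-- decompositions. Counting is done with sums of indicators in ℕ; uniqueness and disjointness take
-- the form of a sum bounded by 1.

private variable
  A B P Q : Set

-- Finite sums

does⇒ : (d : Dec P) → does d ≡ true → P
does⇒ (yes p) _ = p

𝟙 : Bool → ℕ
𝟙 true  = 1
𝟙 false = 0

𝟙≤1 : ∀ b → 𝟙 b ≤ 1
𝟙≤1 true  = s≤s z≤n
𝟙≤1 false = z≤n

𝟙⇒ : ∀ b → 1 ≤ 𝟙 b → b ≡ true
𝟙⇒ true _ = refl

ι : Dec P → ℕ
ι d = 𝟙 (does d)

ι-yes : (d : Dec P) → P → ι d ≡ 1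
ι-yes (yes _) _ = refl
ι-yes (no ¬p) p = ⊥-elim (¬p p)

ι-no : (d : Dec P) → ¬ P → ι d ≡ 0
ι-no (yes p) ¬p = ⊥-elim (¬p p)
ι-no (no _)  _  = refl

ι⇒ : (d : Dec P) → 1 ≤ ι d → P
ι⇒ (yes p) _ = p
ι⇒ (no _) ()

ι≤1 : (d : Dec P) → ι d ≤ 1
ι≤1 d = 𝟙≤1 (does d)

ι-cong : (d : Dec P) (e : Dec Q) → (P → Q) → (Q → P) → ι d ≡ ι e
ι-cong (yes p) e f g = sym (ι-yes e (f p))
ι-cong (no ¬p) e f g = sym (ι-no e (¬p ∘ g))

δ : ∀ {n} → Fin n → Fin n → ℕ
δ i j = ι (i ≟ j)

δ-refl : ∀ {n} (i : Fin n) → δ i i ≡ 1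
δ-refl i = ι-yes (i ≟ i) refl

δ-sym : ∀ {n} (i j : Fin n) → δ i j ≡ δ j i
δ-sym i j = ι-cong (i ≟ j) (j ≟ i) sym sym

δ-refl≥1 : ∀ {n} (i : Fin n) → 1 ≤ δ i i
δ-refl≥1 i = ≤-reflexive (sym (δ-refl i))

δ⇒≡ : ∀ {n} (i j : Fin n) → 1 ≤ δ i j → i ≡ j
δ⇒≡ i j = ι⇒ (i ≟ j)

+-exchange : ∀ a b c → a + (b + c) ≡ b + (a + c)
+-exchange = solve-∀

∑ : List A → (A → ℕ) → ℕ
∑ xs f = sum (map f xs)

∑-cong : (xs : List A) {f g : A → ℕ} → (∀ x → f x ≡ g x) → ∑ xs f ≡ ∑ xs g
∑-cong []       e = refl
∑-cong (x ∷ xs) e = cong₂ _+_ (e x) (∑-cong xs e)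

∑-mono : (xs : List A) {f g : A → ℕ} → (∀ x → f x ≤ g x) → ∑ xs f ≤ ∑ xs g
∑-mono []       e = z≤n
∑-mono (x ∷ xs) e = +-mono-≤ (e x) (∑-mono xs e)

∑-const : (xs : List A) (c : ℕ) → ∑ xs (λ _ → c) ≡ length xs * c
∑-const []       c = refl
∑-const (x ∷ xs) c = cong (c +_) (∑-const xs c)

∑-zero : (xs : List A) → ∑ xs (λ _ → 0) ≡ 0
∑-zero xs = trans (∑-const xs 0) (*-zeroʳ (length xs))

∑-+ : (xs : List A) (f g : A → ℕ) → ∑ xs (λ x → f x + g x) ≡ ∑ xs f + ∑ xs g
∑-+ []       f g = refl
∑-+ (x ∷ xs) f g = trans (cong (f x + g x +_) (∑-+ xs f g)) (interchange (f x) (g x) _ _)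
  where
  interchange : ∀ a b c d → a + b + (c + d) ≡ a + c + (b + d)
  interchange = solve-∀

∑-*ˡ : (xs : List A) (c : ℕ) (f : A → ℕ) → ∑ xs (λ x → c * f x) ≡ c * ∑ xs f
∑-*ˡ []       c f = sym (*-zeroʳ c)
∑-*ˡ (x ∷ xs) c f = trans (cong (c * f x +_) (∑-*ˡ xs c f)) (sym (*-distribˡ-+ c (f x) _))

∑-++ : (xs ys : List A) (f : A → ℕ) → ∑ (xs ++ ys) f ≡ ∑ xs f + ∑ ys f
∑-++ []       ys f = refl
∑-++ (x ∷ xs) ys f = trans (cong (f x +_) (∑-++ xs ys f)) (sym (+-assoc (f x) _ _))

∑-map : (g : A → B) (xs : List A) (f : B → ℕ) → ∑ (map g xs) f ≡ ∑ xs (f ∘ g)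
∑-map g xs f = cong sum (sym (map-∘ xs))

∑-concatMap : (g : A → List B) (xs : List A) (f : B → ℕ) →
  ∑ (concatMap g xs) f ≡ ∑ xs (λ x → ∑ (g x) f)
∑-concatMap g []       f = refl
∑-concatMap g (x ∷ xs) f =
  trans (∑-++ (g x) (concatMap g xs) f) (cong (∑ (g x) f +_) (∑-concatMap g xs f))

∑-replicate : (m : ℕ) (x : A) (f : A → ℕ) → ∑ (replicate m x) f ≡ m * f x
∑-replicate zero    x f = refl
∑-replicate (suc m) x f = cong (f x +_) (∑-replicate m x f)

∑-↭ : {xs ys : List A} (f : A → ℕ) → xs ↭ ys → ∑ xs f ≡ ∑ ys f
∑-↭ f refl         = refl
∑-↭ f (prep x p)   = cong (f x +_) (∑-↭ f p)
∑-↭ f (swap x y p) = trans (cong (λ s → f x + (f y + s)) (∑-↭ f p)) (+-exchange (f x) (f y) _)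
∑-↭ f (↭.trans p q) = trans (∑-↭ f p) (∑-↭ f q)

∑-swap : (xs : List A) (ys : List B) (f : A → B → ℕ) →
  ∑ xs (λ x → ∑ ys (f x)) ≡ ∑ ys (λ y → ∑ xs (λ x → f x y))
∑-swap []       ys f = sym (∑-zero ys)
∑-swap (x ∷ xs) ys f =
  trans (cong (∑ ys (f x) +_) (∑-swap xs ys f)) (sym (∑-+ ys (f x) (λ y → ∑ xs (λ x → f x y))))

∈⇒≤∑ : {xs : List A} {x : A} (f : A → ℕ) → x ∈ xs → f x ≤ ∑ xs f
∈⇒≤∑ f (here refl) = m≤m+n _ _
∈⇒≤∑ {xs = y ∷ _} f (there x∈) = ≤-trans (∈⇒≤∑ f x∈) (m≤n+m _ (f y))

∑-positive : (xs : List A) {f : A → ℕ} → 1 ≤ ∑ xs f → ∃ λ x → x ∈ xs × 1 ≤ f x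
∑-positive (x ∷ xs) {f} p with f x in eq
... | suc _ = x , here refl , subst (1 ≤_) (sym eq) (s≤s z≤n)
... | zero with ∑-positive xs {f} p
...   | y , y∈ , q = y , there y∈ , q

-- Two different positions with positive summands would already contribute 2. Uniqueness of the edge
-- at a vertex, of the successor on a cycle and of the permutation that uses an edge is extracted in
-- this way.
∑≤1⇒≡ : (xs : List A) {f : A → ℕ} {x y : A} → ∑ xs f ≤ 1 →
  x ∈ xs → 1 ≤ f x → y ∈ xs → 1 ≤ f y → x ≡ y
∑≤1⇒≡ (z ∷ xs)     s (here refl) p (here refl) q = refl
∑≤1⇒≡ (z ∷ xs) {f} s (here refl) p (there y∈)  q =
  ⊥-elim (<-irrefl refl (≤-trans (+-mono-≤ p (≤-trans q (∈⇒≤∑ f y∈))) s))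
∑≤1⇒≡ (z ∷ xs) {f} s (there x∈)  p (here refl) q =
  ⊥-elim (<-irrefl refl (≤-trans (+-mono-≤ q (≤-trans p (∈⇒≤∑ f x∈))) s))
∑≤1⇒≡ (z ∷ xs) {f} s (there x∈)  p (there y∈)  q =
  ∑≤1⇒≡ xs (≤-trans (m≤n+m _ (f z)) s) x∈ p y∈ q

-- A converse of `∑≤1⇒≡`. Here `Unique` matters, since a repeated element would be counted once per
-- position.
∑≤1 : {xs : List A} {f : A → ℕ} → Unique xs → (∀ x → f x ≤ 1) →
  (∀ {x y} → 1 ≤ f x → 1 ≤ f y → x ≡ y) → ∑ xs f ≤ 1
∑≤1 []         f≤1 _ = z≤n
∑≤1 {xs = x ∷ xs} {f} (x∉ ∷ u) f≤1 same with f x in fx | f≤1 x | ∑ xs f in rest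
... | zero  | _       | _     = subst (_≤ 1) rest (∑≤1 u f≤1 same)
... | suc _ | s≤s z≤n | zero  = s≤s z≤n
... | suc _ | s≤s z≤n | suc _ with ∑-positive xs {f} (subst (1 ≤_) (sym rest) (s≤s z≤n))
...   | y , y∈ , p = ⊥-elim (All.lookup x∉ y∈ (same (subst (1 ≤_) (sym fx) (s≤s z≤n)) p))

∑-tight : (xs : List A) {f g : A → ℕ} → (∀ x → f x ≤ g x) → ∑ xs g ≤ ∑ xs f →
  ∀ {x} → x ∈ xs → f x ≡ g x
∑-tight (x ∷ xs) {f} {g} f≤g g≤f (here refl) = ≤-antisym (f≤g x)
  (+-cancelʳ-≤ (∑ xs g) _ _ (≤-trans g≤f (+-monoʳ-≤ (f x) (∑-mono xs f≤g))))
∑-tight (x ∷ xs) {f} {g} f≤g g≤f (there y∈) = ∑-tight xs f≤g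
  (+-cancelˡ-≤ (g x) _ _ (≤-trans g≤f (+-monoˡ-≤ (∑ xs f) (f≤g x)))) y∈

∑-allFin-suc : ∀ {n} (f : Fin (suc n) → ℕ) → ∑ (allFin (suc n)) f ≡ f zero + ∑ (allFin n) (f ∘ suc)
∑-allFin-suc f = cong (f zero +_) (cong sum (trans (map-tabulate suc f) (sym (map-tabulate id (f ∘ suc)))))

∑-allFin-const : ∀ n c → ∑ (allFin n) (λ _ → c) ≡ n * c
∑-allFin-const n c = trans (∑-const (allFin n) c) (cong (_* c) (length-tabulate {n = n} id))

∑-δ : ∀ {n} (u : Fin n) (f : Fin n → ℕ) → ∑ (allFin n) (λ i → δ i u * f i) ≡ f u
∑-δ {suc n} zero f = begin
  ∑ (allFin (suc n)) (λ i → δ i zero * f i)    ≡⟨ ∑-allFin-suc (λ i → δ i zero * f i) ⟩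
  f zero + 0 + ∑ (allFin n) (λ _ → 0)          ≡⟨ cong (f zero + 0 +_) (∑-zero (allFin n)) ⟩
  f zero + 0 + 0                               ≡⟨ trans (+-identityʳ _) (+-identityʳ _) ⟩
  f zero                                       ∎
  where open ≡-Reasoning
∑-δ {suc n} (suc u) f = trans (∑-allFin-suc (λ i → δ i (suc u) * f i)) (∑-δ u (f ∘ suc))

∑-δ₁ : ∀ {n} (u : Fin n) → ∑ (allFin n) (λ i → δ i u) ≡ 1
∑-δ₁ {n} u = trans (∑-cong (allFin n) (λ i → sym (*-identityʳ (δ i u)))) (∑-δ u (λ _ → 1))

∑-δ₁ʳ : ∀ {n} (u : Fin n) → ∑ (allFin n) (δ u) ≡ 1
∑-δ₁ʳ {n} u = trans (∑-cong (allFin n) (δ-sym u)) (∑-δ₁ u)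

∑∑-δδ : ∀ {n} (u v : Fin n) (f : Fin n → Fin n → ℕ) →
  ∑ (allFin n) (λ i → ∑ (allFin n) (λ j → δ i u * (δ j v * f i j))) ≡ f u v
∑∑-δδ {n} u v f = begin
  ∑ (allFin n) (λ i → ∑ (allFin n) (λ j → δ i u * (δ j v * f i j)))
    ≡⟨ ∑-cong (allFin n) (λ i → ∑-*ˡ (allFin n) (δ i u) (λ j → δ j v * f i j)) ⟩
  ∑ (allFin n) (λ i → δ i u * ∑ (allFin n) (λ j → δ j v * f i j))
    ≡⟨ ∑-δ u (λ i → ∑ (allFin n) (λ j → δ j v * f i j)) ⟩
  ∑ (allFin n) (λ j → δ j v * f u j)
    ≡⟨ ∑-δ v (f u) ⟩
  f u v ∎
  where open ≡-Reasoning

-- Eulerian orientations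

Flip : A × A → A × A → Set
Flip e e′ = e′ ≡ e ⊎ e′ ≡ ×.swap e

-- An orientation matches its edge list entry by entry, so a reordering of the edges has to be
-- carried over to it before an incident edge can be moved to the front.
↭-Pointwise : {R : A → A → Set} {xs ys zs : List A} → xs ↭ ys → Pointwise R xs zs →
  ∃ λ ws → Pointwise R ys ws × zs ↭ ws
↭-Pointwise refl p = _ , p , refl
↭-Pointwise (prep x q) (r ∷ p) with ↭-Pointwise q p
... | _ , p′ , q′ = _ , r ∷ p′ , prep _ q′
↭-Pointwise (swap x y q) (r ∷ s ∷ p) with ↭-Pointwise q p
... | _ , p′ , q′ = _ , s ∷ r ∷ p′ , swap _ _ q′
↭-Pointwise (↭.trans q₁ q₂) p with ↭-Pointwise q₁ p
... | _ , p₁ , q₁′ with ↭-Pointwise q₂ p₁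
...   | _ , p₂ , q₂′ = _ , p₂ , ↭.trans q₁′ q₂′

∈⇒↭ : {x : A} {xs : List A} → x ∈ xs → ∃ λ ys → xs ↭ x ∷ ys
∈⇒↭ x∈ with ∈-∃++ x∈
... | ys , zs , refl = ys ++ zs , shift _ ys zs

module Orientation (_≟_ : DecidableEquality A) where

  outdeg indeg deg : A → List (A × A) → ℕ
  outdeg v es = ∑ es (λ e → ι (proj₁ e ≟ v))
  indeg  v es = ∑ es (λ e → ι (proj₂ e ≟ v))
  deg    v es = outdeg v es + indeg v es

  Orientable : List (A × A) → Set
  Orientable es = ∃ λ fs → Pointwise Flip es fs × (∀ v → outdeg v fs ≡ indeg v fs)

  Orientable-↭ : ∀ {es fs} → es ↭ fs → Orientable es → Orientable fs
  Orientable-↭ p (es′ , fl , bal) with ↭-Pointwise p fl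
  ... | fs′ , fl′ , q = fs′ , fl′ , λ v → trans (sym (∑-↭ _ q)) (trans (bal v) (∑-↭ _ q))

  deg-↭ : ∀ {es fs} v → es ↭ fs → deg v es ≡ deg v fs
  deg-↭ v p = cong₂ _+_ (∑-↭ _ p) (∑-↭ _ p)

  incident : ∀ u es → 1 ≤ deg u es → ∃₂ λ e w → e ∈ es × (e ≡ (w , u) ⊎ e ≡ (u , w))
  incident u es p with outdeg u es in eq
  ... | suc _ with ∑-positive es {λ e → ι (proj₁ e ≟ u)} (subst (1 ≤_) (sym eq) (s≤s z≤n))
  ...   | (a , w) , e∈ , q with ι⇒ (a ≟ u) q
  ...     | refl = _ , w , e∈ , inj₂ refl
  incident u es p | zero with ∑-positive es {λ e → ι (proj₂ e ≟ u)} p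
  ...   | (w , a) , e∈ , q with ι⇒ (a ≟ u) q
  ...     | refl = _ , w , e∈ , inj₁ refl

  -- The path w–u–v is oriented like the edge w–v that replaces it, so u stays balanced.
  unsplice : ∀ {u v w e es} → (e ≡ (w , u) ⊎ e ≡ (u , w)) →
    Orientable ((w , v) ∷ es) → Orientable ((u , v) ∷ e ∷ es)
  unsplice {u} {v} {w} {e} ends (_ ∷ fs , inj₁ refl ∷ fl , bal) =
    (u , v) ∷ (w , u) ∷ fs , inj₁ refl ∷ flip ends ∷ fl ,
    λ x → through (ι (u ≟ x)) (ι (w ≟ x)) (ι (v ≟ x)) (bal x)
    where
    flip : (e ≡ (w , u) ⊎ e ≡ (u , w)) → Flip e (w , u)
    flip (inj₁ refl) = inj₁ refl
    flip (inj₂ refl) = inj₂ refl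
    through : ∀ a b c {s t} → b + s ≡ c + t → a + (b + s) ≡ c + (a + t)
    through a b c {t = t} p = trans (cong (a +_) p) (+-exchange a c t)
  unsplice {u} {v} {w} {e} ends (_ ∷ fs , inj₂ refl ∷ fl , bal) =
    (v , u) ∷ (u , w) ∷ fs , inj₂ refl ∷ flip ends ∷ fl ,
    λ x → through (ι (u ≟ x)) (ι (w ≟ x)) (ι (v ≟ x)) (bal x)
    where
    flip : (e ≡ (w , u) ⊎ e ≡ (u , w)) → Flip e (u , w)
    flip (inj₁ refl) = inj₂ refl
    flip (inj₂ refl) = inj₁ refl
    through : ∀ a b c {s t} → c + s ≡ b + t → c + (a + s) ≡ a + (b + t)
    through a b c {s} p = trans (+-exchange c a s) (cong (a +_) p)

  -- Splicing at `u` lowers the degree of `u` by 2 and no other, so even degrees stay even. As a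
  -- loop counts twice in `deg`, the equation holds also when some of `u`, `v`, `w` coincide.
  deg-splice : ∀ {u v w e es} x → (e ≡ (w , u) ⊎ e ≡ (u , w)) →
    deg x ((u , v) ∷ e ∷ es) ≡ 2 * ι (u ≟ x) + deg x ((w , v) ∷ es)
  deg-splice {u} {v} {w} {es = es} x (inj₁ refl) =
    regroup (ι (u ≟ x)) (ι (v ≟ x)) (ι (w ≟ x)) (outdeg x es) (indeg x es)
    where
    regroup : ∀ a b c s t → a + (c + s) + (b + (a + t)) ≡ a + (a + 0) + (c + s + (b + t))
    regroup = solve-∀
  deg-splice {u} {v} {w} {es = es} x (inj₂ refl) =
    regroup (ι (u ≟ x)) (ι (v ≟ x)) (ι (w ≟ x)) (outdeg x es) (indeg x es)
    where
    regroup : ∀ a b c s t → a + (a + s) + (b + (c + t)) ≡ a + (a + 0) + (c + s + (b + t))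
    regroup = solve-∀

  deg-loop : ∀ u es x → deg x ((u , u) ∷ es) ≡ 2 * ι (u ≟ x) + deg x es
  deg-loop u es x = assoc (ι (u ≟ x)) (outdeg x es) (indeg x es)
    where
    assoc : ∀ a s t → a + s + (a + t) ≡ a + (a + 0) + (s + t)
    assoc = solve-∀

  deg-head : ∀ {u v} es → u ≢ v → deg u ((u , v) ∷ es) ≡ suc (deg u es)
  deg-head {u} {v} es u≢v rewrite ι-yes (u ≟ u) refl | ι-no (v ≟ u) (u≢v ∘ sym) = refl

  odd⇒positive : ∀ {m} → 2 ∣ suc m → 1 ≤ m
  odd⇒positive {zero}  (divides zero ())
  odd⇒positive {zero}  (divides (suc _) ())
  odd⇒positive {suc m} _ = s≤s z≤n

  even-remainder : ∀ a {s t} → t ≡ 2 * a + s → 2 ∣ t → 2 ∣ s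
  even-remainder a refl 2∣t = ∣m+n∣m⇒∣n 2∣t (m∣m*n a)

  -- Induction on the number of edges: a loop is balanced by itself and dropped; any other head edge
  -- is spliced with a second edge at `u`. The explicit bound `m` is the induction variable because
  -- the spliced list is not a structural part of the original one.
  orient-bounded : ∀ m es → length es ≤ m → (∀ v → 2 ∣ deg v es) → Orientable es
  orient-bounded m [] _ even = [] , [] , λ _ → refl
  orient-bounded (suc m) ((u , v) ∷ es) (s≤s len) even with u ≟ v
  ... | yes refl with orient-bounded m es len
                        (λ x → even-remainder (ι (u ≟ x)) (deg-loop u es x) (even x))
  ...   | fs , fl , bal = (u , u) ∷ fs , inj₁ refl ∷ fl , λ x → cong (ι (u ≟ x) +_) (bal x)
  orient-bounded (suc m) ((u , v) ∷ es) (s≤s len) even | no u≢v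
    -- Since `u ≢ v`, the head edge contributes exactly 1 to the even degree of `u`, so the tail
    -- must contain another edge at `u`.
    with incident u es (odd⇒positive (subst (2 ∣_) (deg-head es u≢v) (even u)))
  ... | e , w , e∈ , ends with ∈⇒↭ e∈
  ...   | es′ , p = Orientable-↭ (prep _ (↭-sym p)) (unsplice ends
            (orient-bounded m ((w , v) ∷ es′) (subst (_≤ m) (↭-length p) len)
              λ x → even-remainder (ι (u ≟ x)) (trans (deg-↭ x (prep _ p)) (deg-splice {es = es′} x ends)) (even x)))

  orient : ∀ es → (∀ v → 2 ∣ deg v es) → Orientable es
  orient es = orient-bounded (length es) es ≤-refl

-- Regular bipartite multigraphs

n<2^n : ∀ n → n < 2 ^ n
n<2^n zero    = s≤s z≤n
n<2^n (suc n) = +-mono-≤ (m^n>0 2 n) (≤-trans (n<2^n n) (m≤m+n _ 0))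

double-cancel : ∀ {x y d} → x ≡ y → x + y ≡ 2 * d → x ≡ d × y ≡ d
double-cancel {x} {d = d} refl p = x≡d , x≡d
  where
  x≡d : x ≡ d
  x≡d = *-cancelˡ-≡ x d 2 (trans (cong (x +_) (+-identityʳ x)) p)

module _ {n : ℕ} where

  -- The entry at `u`, `v` is a multiplicity: of the edge from left vertex `u` to right vertex `v`
  -- in a bipartite multigraph, or of the arc from `u` to `v` in a directed multigraph.
  Matrix : Set
  Matrix = Fin n → Fin n → ℕ

  row col : Matrix → Fin n → ℕ
  row m u = ∑ (allFin n) (m u)
  col m v = ∑ (allFin n) (λ u → m u v)

  edges : Matrix → List (Fin n × Fin n)
  edges m = concatMap (λ u → concatMap (λ v → replicate (m u v) (u , v)) (allFin n)) (allFin n)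

  ∑-edges : ∀ m f → ∑ (edges m) f ≡ ∑ (allFin n) (λ u → ∑ (allFin n) (λ v → m u v * f (u , v)))
  ∑-edges m f = trans (∑-concatMap _ (allFin n) f) (∑-cong (allFin n) λ u →
    trans (∑-concatMap _ (allFin n) f) (∑-cong (allFin n) λ v → ∑-replicate (m u v) (u , v) f))

  left right : Fin n → List (Fin n × Fin n) → ℕ
  left  u es = ∑ es (λ e → δ (proj₁ e) u)
  right v es = ∑ es (λ e → δ (proj₂ e) v)

  left-edges : ∀ m u → left u (edges m) ≡ row m u
  left-edges m u = begin
    left u (edges m)
      ≡⟨ ∑-edges m (λ e → δ (proj₁ e) u) ⟩
    ∑ (allFin n) (λ a → ∑ (allFin n) (λ b → m a b * δ a u))
      ≡⟨ ∑-cong (allFin n) (λ a → trans (∑-cong (allFin n) (λ b → *-comm (m a b) (δ a u))) (∑-*ˡ (allFin n) (δ a u) (m a))) ⟩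
    ∑ (allFin n) (λ a → δ a u * row m a)
      ≡⟨ ∑-δ u (row m) ⟩
    row m u ∎
    where open ≡-Reasoning

  right-edges : ∀ m v → right v (edges m) ≡ col m v
  right-edges m v = begin
    right v (edges m)
      ≡⟨ ∑-edges m (λ e → δ (proj₂ e) v) ⟩
    ∑ (allFin n) (λ a → ∑ (allFin n) (λ b → m a b * δ b v))
      ≡⟨ ∑-cong (allFin n) (λ a → trans (∑-cong (allFin n) (λ b → *-comm (m a b) (δ b v))) (∑-δ v (m a))) ⟩
    col m v ∎
    where open ≡-Reasoning

  Regular : ℕ → List (Fin n × Fin n) → Set
  Regular d es = (∀ u → left u es ≡ d) × (∀ v → right v es ≡ d)

  private
    V : Set
    V = Fin n ⊎ Fin n

    open Orientation {A = V} (≡-dec _≟_ _≟_)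

    arc : Fin n × Fin n → V × V
    arc (u , v) = inj₁ u , inj₂ v

    deg-arcs : ∀ {d} es → Regular d es → ∀ v → deg v (map arc es) ≡ d
    deg-arcs es (l , r) (inj₁ u) = trans (cong₂ _+_ (∑-map arc es _) (trans (∑-map arc es _) (∑-zero es)))
                                         (trans (+-identityʳ _) (l u))
    deg-arcs es (l , r) (inj₂ v) = trans (cong₂ _+_ (trans (∑-map arc es _) (∑-zero es)) (∑-map arc es _)) (r v)

    -- `fs` collects the edges directed from left to right and `gs` the reversed ones. Both
    -- equations hold for every weight, so the same split serves for the degrees and later for the
    -- count of bad edges.
    unflip : ∀ es {as} → Pointwise Flip (map arc es) as → ∃₂ λ fs gs →
      (∀ f → ∑ es f ≡ ∑ fs f + ∑ gs f) ×
      (∀ f → ∑ as f ≡ ∑ fs (f ∘ arc) + ∑ gs (f ∘ ×.swap ∘ arc))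
    unflip [] [] = [] , [] , (λ _ → refl) , (λ _ → refl)
    unflip (e ∷ es) (inj₁ refl ∷ fl) with unflip es fl
    ... | fs , gs , p , q = e ∷ fs , gs ,
      (λ f → trans (cong (f e +_) (p f)) (sym (+-assoc (f e) _ _))) ,
      (λ f → trans (cong (f (arc e) +_) (q f)) (sym (+-assoc (f (arc e)) _ _)))
    unflip (e ∷ es) (inj₂ refl ∷ fl) with unflip es fl
    ... | fs , gs , p , q = fs , e ∷ gs ,
      (λ f → trans (cong (f e +_) (p f)) (+-exchange (f e) (∑ fs f) (∑ gs f))) ,
      (λ f → trans (cong (f (×.swap (arc e)) +_) (q f)) (+-exchange (f (×.swap (arc e))) (∑ fs (f ∘ arc)) (∑ gs (f ∘ ×.swap ∘ arc))))

  -- An Eulerian orientation of a bipartite multigraph sends half of the edges at each vertex to the right.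
  halve : ∀ d es → Regular (2 * d) es → ∃₂ λ fs gs →
    (∀ f → ∑ es f ≡ ∑ fs f + ∑ gs f) × Regular d fs × Regular d gs
  halve d es reg@(l , r)
    with orient (map arc es) (λ v → divides d (trans (deg-arcs es reg v) (*-comm 2 d)))
  ... | as , fl , bal with unflip es fl
  ...   | fs , gs , split , split-arcs = fs , gs , split ,
    (proj₁ ∘ at-left , proj₁ ∘ at-right) , (proj₂ ∘ at-left , proj₂ ∘ at-right)
    where
    at-left : ∀ u → left u fs ≡ d × left u gs ≡ d
    at-left u = double-cancel
      (begin
        left u fs                          ≡⟨ +-identityʳ _ ⟨
        left u fs + 0                      ≡⟨ cong (left u fs +_) (∑-zero gs) ⟨
        left u fs + ∑ gs (λ _ → 0)         ≡⟨ split-arcs _ ⟨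
        outdeg (inj₁ u) as                 ≡⟨ bal (inj₁ u) ⟩
        indeg (inj₁ u) as                  ≡⟨ split-arcs _ ⟩
        ∑ fs (λ _ → 0) + left u gs         ≡⟨ cong (_+ left u gs) (∑-zero fs) ⟩
        left u gs                          ∎)
      (trans (sym (split _)) (l u))
      where open ≡-Reasoning
    at-right : ∀ v → right v fs ≡ d × right v gs ≡ d
    at-right v = double-cancel
      (begin
        right v fs                         ≡⟨ +-identityʳ _ ⟨
        right v fs + 0                     ≡⟨ cong (right v fs +_) (∑-zero gs) ⟨
        right v fs + ∑ gs (λ _ → 0)        ≡⟨ split-arcs _ ⟨
        indeg (inj₂ v) as                  ≡⟨ bal (inj₂ v) ⟨
        outdeg (inj₂ v) as                 ≡⟨ split-arcs _ ⟩
        ∑ fs (λ _ → 0) + right v gs        ≡⟨ cong (_+ right v gs) (∑-zero fs) ⟩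
        right v gs                         ∎)
      (trans (sym (split _)) (r v))
      where open ≡-Reasoning

  -- The two halves share fewer than 2 * 2^t bad edges, so one of them has fewer than 2^t and the
  -- invariant passes to it. At degree 1 the invariant leaves no bad edge.
  1-factor : (bad : Fin n × Fin n → ℕ) → ∀ t es → Regular (2 ^ t) es → ∑ es bad < 2 ^ t →
    ∃ λ fs → Regular 1 fs × ∑ fs bad ≡ 0
  1-factor bad zero    es reg (s≤s few) = es , reg , n≤0⇒n≡0 few
  1-factor bad (suc t) es reg few with halve (2 ^ t) es reg
  ... | fs , gs , split , regf , regg with ∑ fs bad <? 2 ^ t
  ...   | yes fewf = 1-factor bad t fs regf fewf
  ...   | no ¬fewf = 1-factor bad t gs regg (+-cancelˡ-< (2 ^ t) _ _
    (≤-trans (s≤s (+-monoˡ-≤ (∑ gs bad) (≮⇒≥ ¬fewf)))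
      (≤-trans (≤-reflexive (cong suc (sym (split bad))))
        (≤-trans few (≤-reflexive (cong (2 ^ t +_) (+-identityʳ (2 ^ t))))))))

  -- Degree one on each side provides maps in both directions; they are mutually inverse because two
  -- edges of `fs` with a common left or right end coincide.
  1-factor⇒permutation : ∀ {fs : List (Fin n × Fin n)} → Regular 1 fs →
    ∃ λ (π : Permutation′ n) → ∀ u → (u , π ⟨$⟩ʳ u) ∈ fs
  1-factor⇒permutation {fs} (l , r) = permutation to from to∘from from∘to , to∈
    where
    edge-at-left : ∀ u → ∃ λ v → (u , v) ∈ fs
    edge-at-left u with ∑-positive fs (≤-reflexive (sym (l u)))
    ... | (a , v) , e∈ , p with δ⇒≡ a u p
    ...   | refl = v , e∈
    edge-at-right : ∀ v → ∃ λ u → (u , v) ∈ fs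
    edge-at-right v with ∑-positive fs (≤-reflexive (sym (r v)))
    ... | (u , a) , e∈ , p with δ⇒≡ a v p
    ...   | refl = u , e∈
    to from : Fin n → Fin n
    to   u = proj₁ (edge-at-left u)
    from v = proj₁ (edge-at-right v)
    to∈ : ∀ u → (u , to u) ∈ fs
    to∈ u = proj₂ (edge-at-left u)
    from∈ : ∀ v → (from v , v) ∈ fs
    from∈ v = proj₂ (edge-at-right v)
    to∘from : ∀ v → to (from v) ≡ v
    to∘from v = cong proj₂ (∑≤1⇒≡ fs (≤-reflexive (l (from v)))
      (to∈ (from v)) (δ-refl≥1 (from v)) (from∈ v) (δ-refl≥1 (from v)))
    from∘to : ∀ u → from (to u) ≡ u
    from∘to u = cong proj₁ (∑≤1⇒≡ fs (≤-reflexive (r (to u)))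
      (from∈ (to u)) (δ-refl≥1 (to u)) (to∈ u) (δ-refl≥1 (to u)))

  BiRegular : ℕ → Matrix → Set
  BiRegular k m = (∀ u → row m u ≡ k) × (∀ v → col m v ≡ k)

  -- Alon's argument: α copies of m and β < k copies of the identity form a 2^t-regular multigraph with
  -- fewer than 2^t edges outside the support of m; halving and keeping the better half removes all of them.
  abstract
    support-permutation : ∀ k m → .{{NonZero k}} → BiRegular k m →
      ∃ λ (π : Permutation′ n) → ∀ u → 1 ≤ m u (π ⟨$⟩ʳ u)
    support-permutation k m (rows , cols) = π , λ u → n≢0⇒n>0 (support u)
      where
      t α β : ℕ
      -- The identity copies contribute n * β ≤ n * k edges, and any exponent with n * k < 2^t would
      -- do. Division by `k` supplies α and β with α * k + β equal to 2^t, the common row and column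
      -- sum of `M`.
      t = n * k
      α = 2 ^ t / k
      β = 2 ^ t % k
      M : Matrix
      M u v = α * m u v + β * δ u v
      bad : Fin n × Fin n → ℕ
      bad (u , v) = ι (m u v ℕ.≟ 0)
      total : ∀ {s s′} → s ≡ k → s′ ≡ 1 → α * s + β * s′ ≡ 2 ^ t
      total refl refl = trans (+-comm (α * k) (β * 1))
        (trans (cong (_+ α * k) (*-identityʳ β)) (sym (m≡m%n+[m/n]*n (2 ^ t) k)))
      combine : ∀ (f g : Fin n → ℕ) → ∑ (allFin n) (λ i → α * f i + β * g i) ≡
        α * ∑ (allFin n) f + β * ∑ (allFin n) g
      combine f g = trans (∑-+ (allFin n) (λ i → α * f i) (λ i → β * g i))
        (cong₂ _+_ (∑-*ˡ (allFin n) α f) (∑-*ˡ (allFin n) β g))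
      regular : Regular (2 ^ t) (edges M)
      regular =
        (λ u → trans (left-edges M u) (trans (combine (m u) (δ u))
          (total (rows u) (∑-δ₁ʳ u)))) ,
        (λ v → trans (right-edges M v) (trans (combine (λ u → m u v) (λ u → δ u v))
          (total (cols v) (∑-δ₁ v))))
      -- A bad pair has `m u v` equal to 0, so only the identity copies put edges there.
      bad-bound : ∀ u v → M u v * bad (u , v) ≤ β * δ u v
      bad-bound u v with m u v
      ... | zero  = ≤-reflexive (trans (*-identityʳ (α * 0 + β * δ u v)) (cong (_+ β * δ u v) (*-zeroʳ α)))
      ... | suc x = subst (_≤ β * δ u v) (sym (*-zeroʳ (α * suc x + β * δ u v))) z≤n
      few : ∑ (edges M) bad < 2 ^ t
      few = begin-strict
        ∑ (edges M) bad
          ≡⟨ ∑-edges M bad ⟩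
        ∑ (allFin n) (λ u → ∑ (allFin n) (λ v → M u v * bad (u , v)))
          ≤⟨ ∑-mono (allFin n) (λ u → ∑-mono (allFin n) (bad-bound u)) ⟩
        ∑ (allFin n) (λ u → ∑ (allFin n) (λ v → β * δ u v))
          ≡⟨ ∑-cong (allFin n) (λ u → trans (∑-*ˡ (allFin n) β (δ u))
               (trans (cong (β *_) (∑-δ₁ʳ u)) (*-identityʳ β))) ⟩
        ∑ (allFin n) (λ u → β)
          ≡⟨ ∑-allFin-const n β ⟩
        n * β
          ≤⟨ *-monoʳ-≤ n (<⇒≤ (m%n<n (2 ^ t) k)) ⟩
        n * k
          <⟨ n<2^n t ⟩
        2 ^ t ∎
        where open ≤-Reasoning
      factor : ∃ λ fs → Regular 1 fs × ∑ fs bad ≡ 0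
      factor = 1-factor bad t (edges M) regular few
      fs : List (Fin n × Fin n)
      fs = proj₁ factor
      matching : ∃ λ (π : Permutation′ n) → ∀ u → (u , π ⟨$⟩ʳ u) ∈ fs
      matching = 1-factor⇒permutation (proj₁ (proj₂ factor))
      π : Permutation′ n
      π = proj₁ matching
      support : ∀ u → m u (π ⟨$⟩ʳ u) ≢ 0
      support u m≡0 = 1+n≢0 (trans (sym (ι-yes (m u (π ⟨$⟩ʳ u) ℕ.≟ 0) m≡0))
        (n≤0⇒n≡0 (subst (bad (u , π ⟨$⟩ʳ u) ≤_) (proj₂ (proj₂ factor)) (∈⇒≤∑ bad (proj₂ matching u)))))

  permutation-col : ∀ (π : Permutation′ n) v → ∑ (allFin n) (λ u → δ (π ⟨$⟩ʳ u) v) ≡ 1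
  permutation-col π v = trans (∑-cong (allFin n) λ u → ι-cong (π ⟨$⟩ʳ u ≟ v) (u ≟ π ⟨$⟩ˡ v)
      (λ p → trans (sym (inverseˡ π)) (cong (π ⟨$⟩ˡ_) p))
      (λ p → trans (cong (π ⟨$⟩ʳ_) p) (inverseʳ π)))
    (∑-δ₁ (π ⟨$⟩ˡ v))

  permutation-row : ∀ (π : Permutation′ n) u → ∑ (allFin n) (δ (π ⟨$⟩ʳ u)) ≡ 1
  permutation-row π u = ∑-δ₁ʳ (π ⟨$⟩ʳ u)

  remove-permutation : ∀ {k m} (σ : Permutation′ n) → (∀ u → 1 ≤ m u (σ ⟨$⟩ʳ u)) → BiRegular (suc k) m →
    ∃ λ m′ → BiRegular k m′ × ∀ u v → m u v ≡ δ (σ ⟨$⟩ʳ u) v + m′ u v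
  remove-permutation {k} {m} σ support (rows , cols) =
    m′ , (rows′ , cols′) , λ u v → trans (sym (remainder u v)) (+-comm (m′ u v) _)
    where
    -- Truncated subtraction is exact here: `support` makes the entry positive wherever a 1 is taken
    -- away.
    m′ : Matrix
    m′ u v = m u v ∸ δ (σ ⟨$⟩ʳ u) v
    remainder : ∀ u v → m′ u v + δ (σ ⟨$⟩ʳ u) v ≡ m u v
    remainder u v with σ ⟨$⟩ʳ u ≟ v
    ... | yes refl = m∸n+n≡m (support u)
    ... | no  _    = +-identityʳ (m u v)
    rows′ : ∀ u → row m′ u ≡ k
    rows′ u = +-cancelʳ-≡ 1 _ _ (begin
      row m′ u + 1                                      ≡⟨ cong (row m′ u +_) (permutation-row σ u) ⟨
      row m′ u + ∑ (allFin n) (δ (σ ⟨$⟩ʳ u))            ≡⟨ ∑-+ (allFin n) (m′ u) (δ (σ ⟨$⟩ʳ u)) ⟨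
      ∑ (allFin n) (λ v → m′ u v + δ (σ ⟨$⟩ʳ u) v)      ≡⟨ ∑-cong (allFin n) (remainder u) ⟩
      row m u                                           ≡⟨ rows u ⟩
      suc k                                             ≡⟨ +-comm 1 k ⟩
      k + 1                                             ∎)
      where open ≡-Reasoning
    cols′ : ∀ v → col m′ v ≡ k
    cols′ v = +-cancelʳ-≡ 1 _ _ (begin
      col m′ v + 1                                      ≡⟨ cong (col m′ v +_) (permutation-col σ v) ⟨
      col m′ v + ∑ (allFin n) (λ u → δ (σ ⟨$⟩ʳ u) v)    ≡⟨ ∑-+ (allFin n) (λ u → m′ u v) (λ u → δ (σ ⟨$⟩ʳ u) v) ⟨
      ∑ (allFin n) (λ u → m′ u v + δ (σ ⟨$⟩ʳ u) v)      ≡⟨ ∑-cong (allFin n) (λ u → remainder u v) ⟩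
      col m v                                           ≡⟨ cols v ⟩
      suc k                                             ≡⟨ +-comm 1 k ⟩
      k + 1                                             ∎)
      where open ≡-Reasoning

  -- The integral form of the Birkhoff-von Neumann theorem: subtracting a permutation in the support
  -- leaves a matrix with row and column sums smaller by 1.
  birkhoff : ∀ k m → BiRegular k m →
    ∃ λ (π : Fin k → Permutation′ n) → ∀ u v → m u v ≡ ∑ (allFin k) (λ i → δ (π i ⟨$⟩ʳ u) v)
  birkhoff zero m (rows , _) = (λ ()) , λ u v →
    n≤0⇒n≡0 (subst (m u v ≤_) (rows u) (∈⇒≤∑ (m u) (∈-allFin v)))
  birkhoff (suc k) m reg with support-permutation (suc k) m reg
  ... | σ , support with remove-permutation σ support reg
  ...   | m′ , reg′ , split with birkhoff k m′ reg′
  ...     | π , eq = σ∷π , λ u v →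
    trans (split u v) (trans (cong (δ (σ ⟨$⟩ʳ u) v +_) (eq u v)) (sym (∑-allFin-suc (λ i → δ (σ∷π i ⟨$⟩ʳ u) v))))
    where
    σ∷π : Fin (suc k) → Permutation′ n
    σ∷π zero    = σ
    σ∷π (suc i) = π i

-- Eulerian orientations of graphs

-- A weight that ignores direction cannot see the orientation; total degrees and undirected
-- multiplicities therefore survive it.
∑-Flip : {es fs : List (A × A)} (h : A × A → ℕ) → (∀ e → h (×.swap e) ≡ h e) →
  Pointwise Flip es fs → ∑ fs h ≡ ∑ es h
∑-Flip h h-sym []                = refl
∑-Flip h h-sym (inj₁ refl ∷ fl) = cong (h _ +_) (∑-Flip h h-sym fl)
∑-Flip h h-sym (inj₂ refl ∷ fl) = cong₂ _+_ (h-sym _) (∑-Flip h h-sym fl)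

module _ {n : ℕ} where

  open Orientation {A = Fin n} _≟_

  multiplicity : List (Fin n × Fin n) → Matrix
  multiplicity es u v = ∑ es (λ e → δ (proj₁ e) u * δ (proj₂ e) v)

  row-multiplicity : ∀ es u → row (multiplicity es) u ≡ outdeg u es
  row-multiplicity es u = trans (∑-swap (allFin n) es (λ v e → δ (proj₁ e) u * δ (proj₂ e) v))
    (∑-cong es λ e → trans (∑-*ˡ (allFin n) (δ (proj₁ e) u) (δ (proj₂ e)))
      (trans (cong (δ (proj₁ e) u *_) (∑-δ₁ʳ (proj₂ e))) (*-identityʳ _)))

  col-multiplicity : ∀ es v → col (multiplicity es) v ≡ indeg v es
  col-multiplicity es v = trans (∑-swap (allFin n) es (λ u e → δ (proj₁ e) u * δ (proj₂ e) v))
    (∑-cong es λ e → trans (∑-cong (allFin n) (λ u → *-comm (δ (proj₁ e) u) (δ (proj₂ e) v)))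
      (trans (∑-*ˡ (allFin n) (δ (proj₂ e) v) (δ (proj₁ e)))
        (trans (cong (δ (proj₂ e) v *_) (∑-δ₁ʳ (proj₁ e))) (*-identityʳ _))))

  multiplicity-edges : ∀ m u v → multiplicity (edges m) u v ≡ m u v
  multiplicity-edges m u v = trans (∑-edges m _) (trans
    (∑-cong (allFin n) λ a → ∑-cong (allFin n) λ b → reorder (m a b) (δ a u) (δ b v))
    (∑∑-δδ u v m))
    where
    reorder : ∀ a b c → a * (b * c) ≡ b * (c * a)
    reorder = solve-∀

  -- `m` counts the arcs of a balanced orientation of `T`: total degree 2k splits into k out and k
  -- in, and each edge of `T` gets exactly one of its two directions.
  eulerian-matrix : ∀ k (T : Fin n → Fin n → Bool) →
    (∀ u v → T u v ≡ T v u) → (∀ u → T u u ≡ false) → (∀ u → ∑ (allFin n) (𝟙 ∘ T u) ≡ 2 * k) →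
    ∃ λ m → BiRegular k m × ∀ u v → m u v + m v u ≡ 𝟙 (T u v)
  eulerian-matrix k T T-sym T-irrefl rows = m , (rowm , colm) , split
    where
    -- `T` holds every edge in both directions; keeping only the increasing pairs lists each edge
    -- once.
    W : Matrix
    W u v = ι (u Fin.<? v) * 𝟙 (T u v)
    W-split : ∀ u v → W u v + W v u ≡ 𝟙 (T u v)
    W-split u v rewrite T-sym v u with <-cmp u v
    ... | tri< u<v _ v≮u rewrite ι-yes (u Fin.<? v) u<v | ι-no (v Fin.<? u) v≮u =
      trans (+-identityʳ _) (+-identityʳ _)
    ... | tri≈ _ refl _ rewrite T-irrefl u = cong₂ _+_ (*-zeroʳ (ι (u Fin.<? u))) (*-zeroʳ (ι (u Fin.<? u)))
    ... | tri> u≮v _ v<u rewrite ι-no (u Fin.<? v) u≮v | ι-yes (v Fin.<? u) v<u = +-identityʳ _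
    deg-W : ∀ u → deg u (edges W) ≡ 2 * k
    deg-W u = begin
      deg u (edges W)                             ≡⟨ cong₂ _+_ (left-edges W u) (right-edges W u) ⟩
      row W u + col W u                           ≡⟨ ∑-+ (allFin n) (W u) (λ v → W v u) ⟨
      ∑ (allFin n) (λ v → W u v + W v u)          ≡⟨ ∑-cong (allFin n) (W-split u) ⟩
      ∑ (allFin n) (𝟙 ∘ T u)                      ≡⟨ rows u ⟩
      2 * k                                       ∎
      where open ≡-Reasoning
    oriented : Orientable (edges W)
    oriented = orient (edges W) (λ v → divides k (trans (deg-W v) (*-comm 2 k)))
    fs : List (Fin n × Fin n)
    fs = proj₁ oriented
    m : Matrix
    m = multiplicity fs
    deg-fs : ∀ u → deg u fs ≡ 2 * k
    deg-fs u = begin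
      deg u fs                                           ≡⟨ ∑-+ fs _ _ ⟨
      ∑ fs (λ e → δ (proj₁ e) u + δ (proj₂ e) u)
        ≡⟨ ∑-Flip _ (λ e → +-comm (δ (proj₂ e) u) (δ (proj₁ e) u)) (proj₁ (proj₂ oriented)) ⟩
      ∑ (edges W) (λ e → δ (proj₁ e) u + δ (proj₂ e) u)  ≡⟨ ∑-+ (edges W) _ _ ⟩
      deg u (edges W)                                    ≡⟨ deg-W u ⟩
      2 * k                                              ∎
      where open ≡-Reasoning
    halves : ∀ u → outdeg u fs ≡ k × indeg u fs ≡ k
    halves u = double-cancel (proj₂ (proj₂ oriented) u) (deg-fs u)
    rowm : ∀ u → row m u ≡ k
    rowm u = trans (row-multiplicity fs u) (proj₁ (halves u))
    colm : ∀ v → col m v ≡ k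
    colm v = trans (col-multiplicity fs v) (proj₂ (halves v))
    split : ∀ u v → m u v + m v u ≡ 𝟙 (T u v)
    split u v = begin
      m u v + m v u        ≡⟨ ∑-+ fs _ _ ⟨
      ∑ fs both            ≡⟨ ∑-Flip both swap-both (proj₁ (proj₂ oriented)) ⟩
      ∑ (edges W) both     ≡⟨ ∑-+ (edges W) _ _ ⟩
      multiplicity (edges W) u v + multiplicity (edges W) v u
                           ≡⟨ cong₂ _+_ (multiplicity-edges W u v) (multiplicity-edges W v u) ⟩
      W u v + W v u        ≡⟨ W-split u v ⟩
      𝟙 (T u v)            ∎
      where
      open ≡-Reasoning
      both : Fin n × Fin n → ℕ
      both e = δ (proj₁ e) u * δ (proj₂ e) v + δ (proj₁ e) v * δ (proj₂ e) u
      reorder : ∀ a b c d → a * b + c * d ≡ d * c + b * a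
      reorder = solve-∀
      swap-both : ∀ e → both (×.swap e) ≡ both e
      swap-both (a , b) = reorder (δ b u) (δ a v) (δ b v) (δ a u)

-- 2-factors as permutations

zip-proj₁ : ∀ (xs ys : List A) → length xs ≡ length ys → map proj₁ (zip xs ys) ≡ xs
zip-proj₁ []       []       _ = refl
zip-proj₁ (x ∷ xs) (y ∷ ys) p = cong (x ∷_) (zip-proj₁ xs ys (suc-injective p))

zip-proj₂ : ∀ (xs ys : List A) → length xs ≡ length ys → map proj₂ (zip xs ys) ≡ ys
zip-proj₂ []       []       _ = refl
zip-proj₂ (x ∷ xs) (y ∷ ys) p = cong (y ∷_) (zip-proj₂ xs ys (suc-injective p))

module _ {n : ℕ} where

  cycPairs-sources : ∀ (c : List (Fin n)) → map proj₁ (cycPairs c) ≡ c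
  cycPairs-sources []       = refl
  cycPairs-sources (x ∷ xs) = zip-proj₁ (x ∷ xs) (xs ++ [ x ]) (↭-length (++-comm [ x ] xs))

  cycPairs-targets : ∀ (c : List (Fin n)) → map proj₂ (cycPairs c) ↭ c
  cycPairs-targets []       = refl
  cycPairs-targets (x ∷ xs) = ↭.trans
    (↭-reflexive (zip-proj₂ (x ∷ xs) (xs ++ [ x ]) (↭-length (++-comm [ x ] xs)))) (++-comm xs [ x ])

  cycPairs-∈ : ∀ {c : List (Fin n)} {u v} → (u , v) ∈ cycPairs c → u ∈ c × v ∈ c
  cycPairs-∈ {c} e∈ = subst (_ ∈_) (cycPairs-sources c) (∈-map⁺ proj₁ e∈) ,
                      ∈-resp-↭ (cycPairs-targets c) (∈-map⁺ proj₂ e∈)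

  CycEdge-∈ : ∀ {c : List (Fin n)} {u v} → CycEdge c u v → u ∈ c × v ∈ c
  CycEdge-∈ (inj₁ e∈) = cycPairs-∈ e∈
  CycEdge-∈ (inj₂ e∈) = ×.swap (cycPairs-∈ e∈)

-- Orbits of an injective self-map of a finite set

least : {P : ℕ → Set} → Decidable P → ∀ {b} → P b → ∃ λ m → P m × (∀ q → q < m → ¬ P q)
least P? {b} p with P? 0
least P? {b}     p | yes p₀ = 0 , p₀ , λ _ ()
least P? {zero}  p | no ¬p₀ = ⊥-elim (¬p₀ p)
least P? {suc b} p | no ¬p₀ with least (P? ∘ suc) {b} p
... | m , pm , below = suc m , pm , λ { zero _ → ¬p₀ ; (suc q) (s≤s q<m) → below q q<m }

module Iteration {A : Set} (f : A → A) where

  infix 10 _⟨_⟩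
  _⟨_⟩ : A → ℕ → A
  x ⟨ q ⟩ = ℕ.iterate f x q

  -- By definition an iterate unfolds at its starting point, as the list `iterate` does; injectivity
  -- of `f` has to be applied at the other end.
  ⟨⟩-suc : ∀ x q → x ⟨ suc q ⟩ ≡ f (x ⟨ q ⟩)
  ⟨⟩-suc x zero    = refl
  ⟨⟩-suc x (suc q) = ⟨⟩-suc (f x) q

  ∈-iterate⁻ : ∀ {x y} p → y ∈ iterate f x p → ∃ λ q → q < p × y ≡ x ⟨ q ⟩
  ∈-iterate⁻ (suc p) (here eq) = 0 , s≤s z≤n , eq
  ∈-iterate⁻ (suc p) (there y∈) with ∈-iterate⁻ p y∈
  ... | q , q<p , eq = suc q , s≤s q<p , eq

  ∈-iterate⁺ : ∀ {x p} q → q < p → x ⟨ q ⟩ ∈ iterate f x p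
  ∈-iterate⁺ zero    (s≤s _)   = here refl
  ∈-iterate⁺ (suc q) (s≤s q<p) = there (∈-iterate⁺ q q<p)

  iterate-∷ʳ : ∀ x p → iterate f x p ++ [ x ⟨ p ⟩ ] ≡ iterate f x (suc p)
  iterate-∷ʳ x zero    = refl
  iterate-∷ʳ x (suc p) = cong (x ∷_) (iterate-∷ʳ (f x) p)

  zip-iterate : ∀ {a b} x p → (a , b) ∈ zip (iterate f x p) (iterate f (f x) p) → b ≡ f a
  zip-iterate x (suc p) (here refl) = refl
  zip-iterate x (suc p) (there e∈)  = zip-iterate (f x) p e∈

  module _ (f-inj : ∀ {x y} → f x ≡ f y → x ≡ y) where

    ⟨⟩-cancel : ∀ {x} a b → x ⟨ a ⟩ ≡ x ⟨ a + b ⟩ → x ≡ x ⟨ b ⟩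
    ⟨⟩-cancel         zero    b eq = eq
    ⟨⟩-cancel {x = x} (suc a) b eq =
      ⟨⟩-cancel a b (f-inj (trans (sym (⟨⟩-suc x a)) (trans eq (⟨⟩-suc x (a + b)))))

    -- It suffices to exclude returns to the starting point: injectivity cancels any later
    -- repetition back to such a return.
    iterate-unique : ∀ x p → (∀ q → suc q < p → x ⟨ suc q ⟩ ≢ x) → Unique (iterate f x p)
    iterate-unique x zero    no-return = []
    iterate-unique x (suc p) no-return =
      All.tabulate (λ y∈ x≡y → fresh x≡y (∈-iterate⁻ p y∈)) ∷
      iterate-unique (f x) p (λ q q<p eq →
        no-return q (m≤n⇒m≤1+n q<p) (f-inj (trans (sym (⟨⟩-suc x (suc q))) eq)))
      where
      fresh : ∀ {y} → x ≡ y → (∃ λ q → q < p × y ≡ f x ⟨ q ⟩) → ⊥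
      fresh refl (q , q<p , eq) = no-return q (s≤s q<p) (sym eq)

module _ {n : ℕ} (f : Fin n → Fin n) where

  -- `successor` covers the closing pair of the cycle too. `backward` is the closure property behind
  -- disjointness: an orbit that contains an iterate of a vertex contains the vertex.
  record Orbit : Set where
    field
      cyc        : List (Fin n)
      cyc-unique : Unique cyc
      cyc-len    : 3 ≤ length cyc
      successor  : ∀ {u v} → (u , v) ∈ cycPairs cyc → v ≡ f u
      backward   : ∀ {u} → f u ∈ cyc → u ∈ cyc

  Disjoint : Orbit → Orbit → Set
  Disjoint o o′ = ∀ v → v ∈ Orbit.cyc o → v ∈ Orbit.cyc o′ → ⊥

  open Iteration f
  open import Data.List.Membership.DecPropositional (_≟_ {n}) using (_∈?_)

  module _ (f-inj : ∀ {x y} → f x ≡ f y → x ≡ y)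
           (no-1-cycle : ∀ x → f x ≢ x) (no-2-cycle : ∀ x → f (f x) ≢ x) where

    -- Two of the first n + 1 iterates coincide, and injectivity cancels their common initial
    -- stretch.
    returns : ∀ x → ∃ λ p → x ⟨ suc p ⟩ ≡ x
    returns x with pigeonhole (n<1+n n) (λ i → x ⟨ toℕ i ⟩)
    ... | i , j , i<j , eq with m≤n⇒∃[o]m+o≡n i<j
    ...   | o , i+o≡j = o , sym (⟨⟩-cancel f-inj (toℕ i) (suc o)
                              (trans eq (cong (x ⟨_⟩) (trans (sym i+o≡j) (sym (+-suc (toℕ i) o))))))

    -- The cycle lists the iterates up to the least return time `suc d`. Minimality makes them
    -- distinct; counting from `suc` discards the trivial return after zero steps.
    orbit : ∀ x → ∃ λ o → x ∈ Orbit.cyc o × (∀ {y} → y ∈ Orbit.cyc o → ∃ λ q → y ≡ x ⟨ q ⟩)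
    orbit x with least (λ p → x ⟨ suc p ⟩ ≟ x) {proj₁ (returns x)} (proj₂ (returns x))
    ... | d , closed , minimal = record
      { cyc        = iterate f x (suc d)
      ; cyc-unique = iterate-unique f-inj x (suc d) (λ { q (s≤s q<d) → minimal q q<d })
      ; cyc-len    = subst (3 ≤_) (sym (length-iterate f x (suc d))) (long d closed)
      ; successor  = λ {u} {v} e∈ → zip-iterate x (suc d)
          (subst (λ ys → (u , v) ∈ zip (iterate f x (suc d)) ys) rotated e∈)
      ; backward   = λ fu∈ → back (∈-iterate⁻ (suc d) fu∈)
      } , here refl , λ y∈ → let (q , _ , eq) = ∈-iterate⁻ (suc d) y∈ in q , eq
      where
      long : ∀ d → x ⟨ suc d ⟩ ≡ x → 3 ≤ suc d
      long zero          eq = ⊥-elim (no-1-cycle x eq)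
      long (suc zero)    eq = ⊥-elim (no-2-cycle x eq)
      long (suc (suc d)) eq = s≤s (s≤s (s≤s z≤n))
      rotated : iterate f (f x) d ++ [ x ] ≡ iterate f (f x) (suc d)
      rotated = trans (cong (λ y → iterate f (f x) d ++ [ y ]) (sym closed)) (iterate-∷ʳ (f x) d)
      back : ∀ {u} → (∃ λ q → q < suc d × f u ≡ x ⟨ q ⟩) → u ∈ iterate f x (suc d)
      -- The predecessor of the starting point is the last entry of the list, because the orbit
      -- closes up there.
      back (zero , _ , eq) = subst (_∈ iterate f x (suc d))
        (sym (f-inj (trans eq (trans (sym closed) (⟨⟩-suc x d))))) (∈-iterate⁺ d (n<1+n d))
      back (suc q , q<d , eq) = subst (_∈ iterate f x (suc d))
        (sym (f-inj (trans eq (⟨⟩-suc x q)))) (∈-iterate⁺ q (<-trans (n<1+n q) q<d))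

    backward* : ∀ (o : Orbit) x q → x ⟨ q ⟩ ∈ Orbit.cyc o → x ∈ Orbit.cyc o
    backward* o x zero    x∈ = x∈
    backward* o x (suc q) x∈ = Orbit.backward o (backward* o (f x) q x∈)

    -- A new orbit is opened only at a vertex `x` on none of the old ones. A vertex shared with an
    -- old orbit would be an iterate of `x`, and `backward*` would pull `x` itself into that orbit.
    orbit-cover : ∀ xs → ∃ λ os → AllPairs Disjoint os × (∀ {x} → x ∈ xs → Any (λ o → x ∈ Orbit.cyc o) os)
    orbit-cover [] = [] , [] , λ ()
    orbit-cover (x ∷ xs) with orbit-cover xs
    ... | os , disj , cover with Any.any? (λ o → x ∈? Orbit.cyc o) os
    ...   | yes x∈ = os , disj , λ { (here refl) → x∈ ; (there y∈) → cover y∈ }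
    ...   | no ¬x∈ with orbit x
    ...     | o , x∈o , in-orbit = o ∷ os ,
      All.map (λ {o′} x∉o′ y y∈o y∈o′ → let (q , eq) = in-orbit y∈o in
        x∉o′ (backward* o′ x q (subst (_∈ _) eq y∈o′))) (¬Any⇒All¬ os ¬x∈) ∷ disj ,
      λ { (here refl) → here x∈o ; (there y∈) → there (cover y∈) }

AllPairs-lookup : {R : A → A → Set} → (∀ {x y} → R x y → R y x) → ∀ {xs} → AllPairs R xs →
  ∀ i j → i ≢ j → R (lookup xs i) (lookup xs j)
AllPairs-lookup R-sym (r ∷ rs) zero    zero    i≢j = ⊥-elim (i≢j refl)
AllPairs-lookup R-sym (r ∷ rs) zero    (suc j) i≢j = All.lookup r (∈-lookup j)
AllPairs-lookup R-sym (r ∷ rs) (suc i) zero    i≢j = R-sym (All.lookup r (∈-lookup i))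
AllPairs-lookup R-sym (r ∷ rs) (suc i) (suc j) i≢j = AllPairs-lookup R-sym rs i j (i≢j ∘ cong suc)

-- Petersen's 2-factor theorem

module _ {n : ℕ} (G : Graph n) where

  open import Data.List.Membership.DecPropositional (_≟_ {n}) using (_∈?_)

  induced : (c : List (Fin n)) → Unique c → 3 ≤ length c → (∀ {u v} → (u , v) ∈ cycPairs c → Edge G u v) → HamSub G
  induced c unique len adjacent = record
    { cyc        = c
    ; E          = λ u v → (does (u ∈? c) ∧ does (v ∈? c)) ∧ Graph.adj G u v
    ; E-sym      = λ u v → cong₂ _∧_ (∧-comm (does (u ∈? c)) (does (v ∈? c))) (Graph.sym G u v)
    ; E⊆G        = λ u v → ∧-conicalʳ (does (u ∈? c) ∧ does (v ∈? c)) _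
    ; E-ends     = λ u v e → does⇒ (u ∈? c) (∧-conicalˡ (does (u ∈? c)) _ (∧-conicalˡ _ _ e))
    ; cyc-unique = unique
    ; cyc-len    = len
    ; cyc-edges  = λ u v e → cong₂ _∧_ (cong₂ _∧_ (dec-true (u ∈? c) (proj₁ (CycEdge-∈ e)))
                                                  (dec-true (v ∈? c) (proj₂ (CycEdge-∈ e)))) (edge e)
    }
    where
    edge : ∀ {u v} → CycEdge c u v → Edge G u v
    edge         (inj₁ e∈) = adjacent e∈
    edge {u} {v} (inj₂ e∈) = trans (Graph.sym G u v) (adjacent e∈)

  -- The second component remembers that every cycle edge is a step of `f`; this is what allows
  -- cycles of different decompositions to be compared.
  orbit-HLD : (f : Fin n → Fin n) → (∀ {x y} → f x ≡ f y → x ≡ y) →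
    (∀ x → Edge G x (f x)) → (∀ x → f (f x) ≢ x) →
    ∃ λ (D : HLD G) → ∀ s {u v} → CycEdge (HamSub.cyc (HLD.part D s)) u v → f u ≡ v ⊎ f v ≡ u
  orbit-HLD f f-inj adjacent no-2-cycle
    with orbit-cover f f-inj no-1-cycle no-2-cycle (allFin n)
    where
    no-1-cycle : ∀ x → f x ≢ x
    no-1-cycle x fx≡x with trans (sym (adjacent x)) (trans (cong (Graph.adj G x) fx≡x) (Graph.irrefl G x))
    ... | ()
  ... | os , disj , cover = record
    { t        = length os
    ; part     = sub ∘ lookup os
    ; disjoint = AllPairs-lookup (λ d v v∈ v∈′ → d v v∈′ v∈) disj
    ; cover    = λ v → Any.index (cover (∈-allFin v)) , lookup-index (cover (∈-allFin v))
    } , λ s → ⊎.map (sym ∘ Orbit.successor (lookup os s)) (sym ∘ Orbit.successor (lookup os s))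
    where
    sub : Orbit f → HamSub G
    sub o = induced (Orbit.cyc o) (Orbit.cyc-unique o) (Orbit.cyc-len o)
      (λ {u} e∈ → subst (Edge G u) (sym (Orbit.successor o e∈)) (adjacent u))

  petersen : ∀ k (T : Fin n → Fin n → Bool) → (∀ u v → T u v ≡ T v u) →
    (∀ u v → T u v ≡ true → Edge G u v) → (∀ u → ∑ (allFin n) (𝟙 ∘ T u) ≡ 2 * k) → kHLD G k
  petersen k T T-sym T⊆G rows with eulerian-matrix k T T-sym T-irrefl rows
    where
    T-irrefl : ∀ u → T u u ≡ false
    T-irrefl u with T u u in eq
    ... | false = refl
    ... | true  = trans (sym (T⊆G u u eq)) (Graph.irrefl G u)
  ... | m , reg , split with birkhoff k m reg
  ...   | π , decomposition = (λ i → proj₁ (hld i)) , disjoint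
    where
    f : Fin k → Fin n → Fin n
    f i u = π i ⟨$⟩ʳ u
    -- Steps between `u` and `v` are counted in both directions, so that the total over all
    -- permutations is the 0/1 indicator of the undirected edge in `T`.
    uses : Fin n → Fin n → Fin k → ℕ
    uses u v i = δ (f i u) v + δ (f i v) u
    total : ∀ u v → ∑ (allFin k) (uses u v) ≡ 𝟙 (T u v)
    total u v = trans (∑-+ (allFin k) (λ i → δ (f i u) v) (λ i → δ (f i v) u))
      (trans (sym (cong₂ _+_ (decomposition u v) (decomposition v u))) (split u v))
    total≤1 : ∀ u v → ∑ (allFin k) (uses u v) ≤ 1
    total≤1 u v = ≤-trans (≤-reflexive (total u v)) (𝟙≤1 (T u v))
    ∈uses : ∀ {u v} i → f i u ≡ v ⊎ f i v ≡ u → 1 ≤ uses u v i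
    ∈uses {u}     i (inj₁ refl) = ≤-trans (δ-refl≥1 (f i u)) (m≤m+n _ _)
    ∈uses {v = v} i (inj₂ refl) = ≤-trans (δ-refl≥1 (f i v)) (m≤n+m _ _)
    adjacent : ∀ i u → Edge G u (f i u)
    adjacent i u = T⊆G u (f i u) (𝟙⇒ _ (subst (1 ≤_) (total u (f i u))
      (≤-trans (∈uses i (inj₁ refl)) (∈⇒≤∑ (uses u (f i u)) (∈-allFin i)))))
    -- A 2-cycle would traverse its edge both ways, so the index `i` alone would contribute 2.
    no-2-cycle : ∀ i u → f i (f i u) ≢ u
    no-2-cycle i u eq = <-irrefl refl (≤-trans
      (+-mono-≤ (δ-refl≥1 (f i u)) (≤-reflexive (sym (ι-yes (f i (f i u) ≟ u) eq))))
      (≤-trans (∈⇒≤∑ (uses u (f i u)) (∈-allFin i)) (total≤1 u (f i u))))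
    f-inj : ∀ i {u v} → f i u ≡ f i v → u ≡ v
    f-inj i eq = trans (sym (inverseˡ (π i))) (trans (cong (π i ⟨$⟩ˡ_) eq) (inverseˡ (π i)))
    hld : ∀ i → ∃ λ (D : HLD G) → ∀ s {u v} → CycEdge (HamSub.cyc (HLD.part D s)) u v → f i u ≡ v ⊎ f i v ≡ u
    hld i = orbit-HLD (f i) (f-inj i) (adjacent i) (no-2-cycle i)
    disjoint : ∀ (a b : HIdx G k (λ i → proj₁ (hld i))) → a ≢ b → ∀ u v →
      CycEdge (cycOf G k (λ i → proj₁ (hld i)) a) u v → CycEdge (cycOf G k (λ i → proj₁ (hld i)) b) u v → ⊥
    disjoint (i , s) (j , r) a≢b u v ea eb
      with ∑≤1⇒≡ (allFin k) (total≤1 u v) (∈-allFin i) (∈uses i (proj₂ (hld i) s ea))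
                                          (∈-allFin j) (∈uses j (proj₂ (hld j) r eb))
    -- A common edge forces the same permutation; distinct cycles of one decomposition do not even
    -- share a vertex.
    ... | refl = HLD.disjoint (proj₁ (hld i)) s r (a≢b ∘ cong (i ,_)) u (proj₁ (CycEdge-∈ ea)) (proj₁ (CycEdge-∈ eb))

-- Decompositions as regular spanning subgraphs

zip-∷ʳ : ∀ (xs ys : List A) x y → length xs ≡ length ys → zip (xs ++ [ x ]) (ys ++ [ y ]) ≡ zip xs ys ++ [ x , y ]
zip-∷ʳ []       []       x y _ = refl
zip-∷ʳ (a ∷ xs) (b ∷ ys) x y p = cong ((a , b) ∷_) (zip-∷ʳ xs ys x y (suc-injective p))

module _ {n : ℕ} where

  open Orientation {A = Fin n} _≟_

  cycPairs-rotate₁ : ∀ x (xs : List (Fin n)) → cycPairs (x ∷ xs) ↭ cycPairs (xs ++ [ x ])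
  cycPairs-rotate₁ x []       = refl
  cycPairs-rotate₁ x (y ∷ ys) = ↭.trans (++-comm [ x , y ] (zip (y ∷ ys) (ys ++ [ x ])))
    (↭-reflexive (sym (zip-∷ʳ (y ∷ ys) (ys ++ [ x ]) x y (↭-length (++-comm [ x ] ys)))))

  -- The closing pair singles out the first entry of the list, but the cycle does not depend on it;
  -- any vertex may thus be assumed to come first.
  cycPairs-rotate : ∀ (xs ys : List (Fin n)) → cycPairs (xs ++ ys) ↭ cycPairs (ys ++ xs)
  cycPairs-rotate []       ys = ↭-reflexive (cong cycPairs (sym (++-identityʳ ys)))
  cycPairs-rotate (x ∷ xs) ys = ↭.trans (cycPairs-rotate₁ x (xs ++ ys)) (↭.trans
    (↭-reflexive (cong cycPairs (++-assoc xs ys [ x ]))) (↭.trans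
    (cycPairs-rotate xs (ys ++ [ x ]))
    (↭-reflexive (cong cycPairs (++-assoc ys [ x ] xs)))))

  occurrences : List (Fin n) → Fin n → ℕ
  occurrences c u = ∑ c (λ x → δ x u)

  unique⇒occurrences≤1 : ∀ {c} → Unique c → ∀ u → occurrences c u ≤ 1
  unique⇒occurrences≤1 unique u = ∑≤1 unique (λ x → ι≤1 (x ≟ u))
    (λ {x} {y} p q → trans (δ⇒≡ x u p) (sym (δ⇒≡ y u q)))

  outdeg-cycPairs : ∀ c u → outdeg u (cycPairs c) ≡ occurrences c u
  outdeg-cycPairs c u = trans (sym (∑-map proj₁ (cycPairs c) _)) (cong (λ xs → occurrences xs u) (cycPairs-sources c))

  indeg-cycPairs : ∀ c u → indeg u (cycPairs c) ≡ occurrences c u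
  indeg-cycPairs c u = trans (sym (∑-map proj₂ (cycPairs c) _)) (∑-↭ _ (cycPairs-targets c))

  successor-unique : ∀ {c u v w} → Unique c → (u , v) ∈ cycPairs c → (u , w) ∈ cycPairs c → v ≡ w
  successor-unique {c} {u} unique p q = cong proj₂ (∑≤1⇒≡ (cycPairs c)
    (≤-trans (≤-reflexive (outdeg-cycPairs c u)) (unique⇒occurrences≤1 unique u)) p (δ-refl≥1 u) q (δ-refl≥1 u))

  -- With the cycle rotated to start at `u`, unique successors force the entries `u`, `v`, `u`.
  -- Length at least 3 makes the third entry a genuine list entry and not the wrap-around, so `u`
  -- would occur twice.
  antisymmetric : ∀ {c u v} → Unique c → 3 ≤ length c → (u , v) ∈ cycPairs c → (v , u) ∈ cycPairs c → ⊥
  antisymmetric {c} {u} {v} unique len uv vu with ∈-∃++ (proj₁ (cycPairs-∈ {c = c} uv))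
  ... | as , bs , refl = go (bs ++ as) (subst (3 ≤_) (↭-length (++-comm as (u ∷ bs))) len)
      (∈-resp-↭ (↭-sym (cycPairs-rotate as (u ∷ bs))))
      (subst (_≤ 1) (∑-↭ (λ x → δ x u) (++-comm as (u ∷ bs))) (unique⇒occurrences≤1 unique u))
    where
    go : ∀ zs → 3 ≤ suc (length zs) → (∀ {e} → e ∈ cycPairs (u ∷ zs) → e ∈ cycPairs c) →
      occurrences (u ∷ zs) u ≤ 1 → ⊥
    go (y ∷ [])     (s≤s (s≤s ())) _ _
    go (y ∷ z ∷ zs) _ sub once with successor-unique unique uv (sub (here refl))
    ... | refl with successor-unique unique vu (sub (there (here refl)))
    ...   | refl = <-irrefl refl (≤-trans (+-mono-≤ (δ-refl≥1 u)
      (≤-trans (δ-refl≥1 u) (∈⇒≤∑ {xs = v ∷ u ∷ zs} (λ x → δ x u) (there (here refl))))) once)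

  adjacency : List (Fin n) → Matrix
  adjacency c u v = multiplicity (cycPairs c) u v + multiplicity (cycPairs c) v u

  multiplicity⇒∈ : ∀ (es : List (Fin n × Fin n)) u v → 1 ≤ multiplicity es u v → (u , v) ∈ es
  multiplicity⇒∈ es u v p with ∑-positive es p
  ... | (a , b) , e∈ , q with a ≟ u | b ≟ v
  ...   | yes refl | yes refl = e∈
  ...   | yes refl | no _ = ⊥-elim (n≮0 q)
  ...   | no _     | _    = ⊥-elim (n≮0 q)

  adjacency⇒CycEdge : ∀ c u v → 1 ≤ adjacency c u v → CycEdge c u v
  adjacency⇒CycEdge c u v p with multiplicity (cycPairs c) u v in eq
  ... | suc _ = inj₁ (multiplicity⇒∈ (cycPairs c) u v (subst (1 ≤_) (sym eq) (s≤s z≤n)))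
  ... | zero  = inj₂ (multiplicity⇒∈ (cycPairs c) v u p)

  multiplicity≤1 : ∀ {c} → Unique c → ∀ u v → multiplicity (cycPairs c) u v ≤ 1
  multiplicity≤1 {c} unique u v = ≤-trans
    (∑-mono (cycPairs c) (λ e → ≤-trans (*-monoʳ-≤ (δ (proj₁ e) u) (ι≤1 (proj₂ e ≟ v))) (≤-reflexive (*-identityʳ _))))
    (≤-trans (≤-reflexive (outdeg-cycPairs c u)) (unique⇒occurrences≤1 unique u))

  adjacency≤1 : ∀ {c} → Unique c → 3 ≤ length c → ∀ u v → adjacency c u v ≤ 1
  adjacency≤1 {c} unique len u v = exclusive (multiplicity≤1 unique u v) (multiplicity≤1 unique v u)
    λ p q → antisymmetric {c} unique len (multiplicity⇒∈ (cycPairs c) u v p) (multiplicity⇒∈ (cycPairs c) v u q)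
    where
    exclusive : ∀ {a b} → a ≤ 1 → b ≤ 1 → (1 ≤ a → 1 ≤ b → ⊥) → a + b ≤ 1
    exclusive z≤n       b≤1       _ = b≤1
    exclusive (s≤s z≤n) z≤n       _ = s≤s z≤n
    exclusive (s≤s z≤n) (s≤s z≤n) f = ⊥-elim (f (s≤s z≤n) (s≤s z≤n))

  row-adjacency : ∀ c u → row (adjacency c) u ≡ 2 * occurrences c u
  row-adjacency c u = trans (∑-+ (allFin n) (multiplicity (cycPairs c) u) (λ v → multiplicity (cycPairs c) v u))
    (cong₂ _+_ (trans (row-multiplicity (cycPairs c) u) (outdeg-cycPairs c u))
      (trans (col-multiplicity (cycPairs c) u) (trans (indeg-cycPairs c u) (sym (+-identityʳ _)))))

  occurrences⇒∈ : ∀ c u → 1 ≤ occurrences c u → u ∈ c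
  occurrences⇒∈ c u p with ∑-positive c p
  ... | x , x∈ , q = subst (_∈ c) (δ⇒≡ x u q) x∈

  ∈⇒occurrences : ∀ {c u} → u ∈ c → 1 ≤ occurrences c u
  ∈⇒occurrences {c} {u} u∈ = ≤-trans (δ-refl≥1 u) (∈⇒≤∑ (λ x → δ x u) u∈)

module _ {n : ℕ} (G : Graph n) where

  module _ (D : HLD G) where
    open HLD D

    cycles : Fin t → List (Fin n)
    cycles s = HamSub.cyc (part s)

    same-part : ∀ {s r v} → v ∈ cycles s → v ∈ cycles r → s ≡ r
    same-part {s} {r} {v} p q with s ≟ r
    ... | yes s≡r = s≡r
    ... | no  s≢r = ⊥-elim (disjoint s r s≢r v p q)

    covered-once : ∀ u → ∑ (allFin t) (λ s → occurrences (cycles s) u) ≡ 1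
    covered-once u = ≤-antisym
      (∑≤1 (allFin⁺ t) (λ s → unique⇒occurrences≤1 (HamSub.cyc-unique (part s)) u)
        (λ {s} {r} p q → same-part (occurrences⇒∈ (cycles s) u p) (occurrences⇒∈ (cycles r) u q)))
      (≤-trans (∈⇒occurrences (proj₂ (cover u)))
        (∈⇒≤∑ (λ s → occurrences (cycles s) u) (∈-allFin (proj₁ (cover u)))))

    2-factor : Matrix
    2-factor u v = ∑ (allFin t) (λ s → adjacency (cycles s) u v)

    2-factor-sym : ∀ u v → 2-factor u v ≡ 2-factor v u
    2-factor-sym u v = ∑-cong (allFin t) (λ s → +-comm (multiplicity (cycPairs (cycles s)) u v) _)

    2-factor⇒CycEdge : ∀ u v → 1 ≤ 2-factor u v → ∃ λ s → CycEdge (cycles s) u v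
    2-factor⇒CycEdge u v p with ∑-positive (allFin t) p
    ... | s , _ , q = s , adjacency⇒CycEdge (cycles s) u v q

    2-factor≤1 : ∀ u v → 2-factor u v ≤ 1
    2-factor≤1 u v = ∑≤1 (allFin⁺ t)
      (λ s → adjacency≤1 (HamSub.cyc-unique (part s)) (HamSub.cyc-len (part s)) u v)
      (λ {s} {r} p q → same-part (proj₁ (CycEdge-∈ (adjacency⇒CycEdge (cycles s) u v p)))
                                 (proj₁ (CycEdge-∈ (adjacency⇒CycEdge (cycles r) u v q))))

    row-2-factor : ∀ u → row 2-factor u ≡ 2
    row-2-factor u = begin
      row 2-factor u
        ≡⟨ ∑-swap (allFin n) (allFin t) (λ v s → adjacency (cycles s) u v) ⟩
      ∑ (allFin t) (λ s → row (adjacency (cycles s)) u)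
        ≡⟨ ∑-cong (allFin t) (λ s → row-adjacency (cycles s) u) ⟩
      ∑ (allFin t) (λ s → 2 * occurrences (cycles s) u)
        ≡⟨ ∑-*ˡ (allFin t) 2 (λ s → occurrences (cycles s) u) ⟩
      2 * ∑ (allFin t) (λ s → occurrences (cycles s) u)
        ≡⟨ cong (2 *_) (covered-once u) ⟩
      2 ∎
      where open ≡-Reasoning

  -- `M` adds up all cycles of all decompositions. No cycle repeats an edge, cycles within a
  -- decomposition are vertex-disjoint, and edges of different decompositions are disjoint by
  -- hypothesis; so `M` is 0/1 and its row sums are the degrees of `T`.
  kHLD⇒regular : ∀ k → kHLD G k → ∃ λ (T : Fin n → Fin n → Bool) →
    (∀ u v → T u v ≡ T v u) × (∀ u v → T u v ≡ true → Edge G u v) × (∀ u → ∑ (allFin n) (𝟙 ∘ T u) ≡ 2 * k)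
  kHLD⇒regular k (D , edge-disjoint) = T , T-sym , T⊆G , rows
    where
    M : Matrix
    M u v = ∑ (allFin k) (λ i → 2-factor (D i) u v)
    T : Fin n → Fin n → Bool
    T u v = does (1 ℕ.≤? M u v)
    M-sym : ∀ u v → M u v ≡ M v u
    M-sym u v = ∑-cong (allFin k) (λ i → 2-factor-sym (D i) u v)
    same-index : ∀ u v {i j} → 1 ≤ 2-factor (D i) u v → 1 ≤ 2-factor (D j) u v → i ≡ j
    same-index u v {i} {j} p q with i ≟ j
    ... | yes i≡j = i≡j
    ... | no  i≢j with 2-factor⇒CycEdge (D i) u v p | 2-factor⇒CycEdge (D j) u v q
    ...   | s , e | r , e′ = ⊥-elim (edge-disjoint (i , s) (j , r) (i≢j ∘ cong proj₁) u v e e′)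
    M≤1 : ∀ u v → M u v ≤ 1
    M≤1 u v = ∑≤1 (allFin⁺ k) (λ i → 2-factor≤1 (D i) u v) (same-index u v)
    𝟙-T : ∀ u v → 𝟙 (T u v) ≡ M u v
    𝟙-T u v with M u v | M≤1 u v
    ... | zero  | _       = refl
    ... | suc _ | s≤s z≤n = refl
    T-sym : ∀ u v → T u v ≡ T v u
    T-sym u v = cong (λ m → does (1 ℕ.≤? m)) (M-sym u v)
    T⊆G : ∀ u v → T u v ≡ true → Edge G u v
    T⊆G u v p with ∑-positive (allFin k) (does⇒ (1 ℕ.≤? M u v) p)
    ... | i , _ , q with 2-factor⇒CycEdge (D i) u v q
    ...   | s , e = HamSub.E⊆G (HLD.part (D i) s) u v (HamSub.cyc-edges (HLD.part (D i) s) u v e)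
    rows : ∀ u → ∑ (allFin n) (𝟙 ∘ T u) ≡ 2 * k
    rows u = begin
      ∑ (allFin n) (𝟙 ∘ T u)               ≡⟨ ∑-cong (allFin n) (𝟙-T u) ⟩
      row M u                              ≡⟨ ∑-swap (allFin n) (allFin k) (λ v i → 2-factor (D i) u v) ⟩
      ∑ (allFin k) (λ i → row (2-factor (D i)) u)  ≡⟨ ∑-cong (allFin k) (λ i → row-2-factor (D i) u) ⟩
      ∑ (allFin k) (λ _ → 2)               ≡⟨ ∑-allFin-const k 2 ⟩
      k * 2                                ≡⟨ *-comm k 2 ⟩
      2 * k                                ∎
      where open ≡-Reasoning

-- Neighbourhoods in the inflated graph

module _ {n : ℕ} where

  b2n≡𝟙 : ∀ b → b2n {n} b ≡ 𝟙 b
  b2n≡𝟙 true  = refl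
  b2n≡𝟙 false = refl

  count≡∑ : ∀ (p : Fin n → Bool) → count p ≡ ∑ (allFin n) (𝟙 ∘ p)
  count≡∑ p = ∑-cong (allFin n) (b2n≡𝟙 ∘ p)

  count₂≡∑∑ : ∀ (p : Fin n → Fin n → Bool) → count₂ p ≡ ∑ (allFin n) (λ i → ∑ (allFin n) (𝟙 ∘ p i))
  count₂≡∑∑ p = ∑-cong (allFin n) (count≡∑ ∘ p)

  -- The neighbours of (`i`, `j`) are its clique without the vertex itself, plus the partner (`j`,
  -- `i`); the removed vertex is added on the left to avoid subtraction. As `i ≢ j`, the partner
  -- lies outside the clique and nothing is counted twice.
  𝟙-IAdj : ∀ {i j : Fin n} → i ≢ j → ∀ a b x →
    𝟙 (x ∧ IAdj i j a b) + δ a i * (δ b j * 𝟙 x) ≡ δ a i * 𝟙 x + δ a j * (δ b i * 𝟙 x)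
  𝟙-IAdj {i} {j} i≢j a b x
    rewrite δ-sym a i | δ-sym b j | δ-sym a j | δ-sym b i
          | isYes≗does (i ≟ a) | isYes≗does (j ≟ b) | isYes≗does (i ≟ b) | isYes≗does (j ≟ a) =
    table (does (i ≟ a)) (does (j ≟ b)) (does (i ≟ b)) (does (j ≟ a)) x exclusive
    where
    exclusive : does (i ≟ a) ∧ does (j ≟ a) ≡ false
    exclusive with i ≟ a | j ≟ a
    ... | yes refl | yes refl = ⊥-elim (i≢j refl)
    ... | yes _    | no _     = refl
    ... | no _     | _        = refl
    table : ∀ p q r s x → p ∧ s ≡ false →
      𝟙 (x ∧ ((p ∧ not q) ∨ (r ∧ s))) + 𝟙 p * (𝟙 q * 𝟙 x) ≡ 𝟙 p * 𝟙 x + 𝟙 s * (𝟙 r * 𝟙 x)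
    table true  q     r     false x     _ rewrite ∧-zeroʳ r = clique q x
      where
      clique : ∀ q x → 𝟙 (x ∧ (not q ∨ false)) + 1 * (𝟙 q * 𝟙 x) ≡ 1 * 𝟙 x + 0
      clique true  true  = refl
      clique true  false = refl
      clique false true  = refl
      clique false false = refl
    table false q     true  true  true  _ = refl
    table false q     true  true  false _ = refl
    table false q     false true  true  _ = refl
    table false q     false true  false _ = refl
    table false q     r     false x     _ rewrite ∧-zeroʳ r | ∧-zeroʳ x = refl

  module _ (G : Graph n) (S : ISubset {n}) where

    member : Fin n → Fin n → Bool
    member i j = IVertex G i j ∧ S i j

    members : Fin n → ℕ
    members i = ∑ (allFin n) (𝟙 ∘ member i)

    Icard≡ : Icard G S ≡ ∑ (allFin n) members
    Icard≡ = count₂≡∑∑ member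

    Edge⇒≢ : ∀ {i j} → Edge G i j → i ≢ j
    Edge⇒≢ {i} e refl with trans (sym e) (Graph.irrefl G i)
    ... | ()

    Inbrs-balance : ∀ {i j} → Edge G i j →
      Inbrs G S i j + 𝟙 (member i j) ≡ members i + 𝟙 (member j i)
    Inbrs-balance {i} {j} e = begin
      Inbrs G S i j + 𝟙 (member i j)
        ≡⟨ cong₂ _+_ (trans (count₂≡∑∑ _)
             (∑-cong (allFin n) λ a → ∑-cong (allFin n) λ b →
               cong 𝟙 (sym (∧-assoc (IVertex G a b) (S a b) (IAdj i j a b)))))
             (sym (∑∑-δδ i j h)) ⟩
      ∑ (allFin n) (λ a → ∑ (allFin n) (nbr a)) + ∑ (allFin n) (λ a → ∑ (allFin n) (at i j a))
        ≡⟨ ∑∑-+ nbr (at i j) ⟨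
      ∑ (allFin n) (λ a → ∑ (allFin n) (λ b → nbr a b + at i j a b))
        ≡⟨ ∑-cong (allFin n) (λ a → ∑-cong (allFin n) (λ b → 𝟙-IAdj (Edge⇒≢ e) a b (member a b))) ⟩
      ∑ (allFin n) (λ a → ∑ (allFin n) (λ b → δ a i * h a b + at j i a b))
        ≡⟨ ∑∑-+ (λ a b → δ a i * h a b) (at j i) ⟩
      ∑ (allFin n) (λ a → ∑ (allFin n) (λ b → δ a i * h a b)) + ∑ (allFin n) (λ a → ∑ (allFin n) (at j i a))
        ≡⟨ cong₂ _+_ (trans (∑-cong (allFin n) (λ a → ∑-*ˡ (allFin n) (δ a i) (h a))) (∑-δ i members)) (∑∑-δδ j i h) ⟩
      members i + 𝟙 (member j i) ∎
      where
      open ≡-Reasoning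
      h nbr : Fin n → Fin n → ℕ
      h a b = 𝟙 (member a b)
      nbr a b = 𝟙 (member a b ∧ IAdj i j a b)
      at : Fin n → Fin n → Fin n → Fin n → ℕ
      at i j a b = δ a i * (δ b j * h a b)
      ∑∑-+ : ∀ (f g : Fin n → Fin n → ℕ) → ∑ (allFin n) (λ a → ∑ (allFin n) (λ b → f a b + g a b)) ≡
        ∑ (allFin n) (λ a → ∑ (allFin n) (f a)) + ∑ (allFin n) (λ a → ∑ (allFin n) (g a))
      ∑∑-+ f g = trans (∑-cong (allFin n) (λ a → ∑-+ (allFin n) (f a) (g a))) (∑-+ (allFin n) _ _)

    𝟙-member : ∀ i j → (Edge G i j → 𝟙 (member i j) ≡ 0) → 𝟙 (member i j) ≡ 0
    𝟙-member i j vanish with Graph.adj G i j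
    ... | true  = vanish refl
    ... | false = refl

    module _ (k : ℕ) (k≥1 : 1 ≤ 2 * k) (δ≥2k : ∀ v → 2 * k ≤ degree G v) where

      -- An empty clique would impose no domination condition; the degree bound supplies a vertex of
      -- `X_i` to which domination applies.
      neighbour : ∀ i → ∃ λ j → Edge G i j
      neighbour i with ∑-positive (allFin n) {𝟙 ∘ Graph.adj G i}
                         (≤-trans k≥1 (subst (2 * k ≤_) (count≡∑ (Graph.adj G i)) (δ≥2k i)))
      ... | j , _ , p = j , 𝟙⇒ (Graph.adj G i j) p

      -- Evenness raises the threshold from 1 to 2, beyond the single neighbour that a vertex of the
      -- inflated graph has outside its own clique.
      2k≰1 : ¬ 2 * k ≤ 1
      2k≰1 = even≰1 k k≥1
        where
        even≰1 : ∀ k → 1 ≤ 2 * k → ¬ 2 * k ≤ 1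
        even≰1 (suc k) _ (s≤s p) = n≮0 (subst (_≤ 0) (+-suc k (k + 0)) p)

      module _ (dominating : IsKTupleTDS-I G (2 * k) S) where

        balance : ∀ {i j} → Edge G i j → 2 * k + 𝟙 (member i j) ≤ members i + 𝟙 (member j i)
        balance {i} {j} e = ≤-trans (+-monoˡ-≤ (𝟙 (member i j)) (dominating i j e)) (≤-reflexive (Inbrs-balance e))

        -- If X_i had at most 2k - 1 members, then every x_i x_j would lie outside S (and x_j x_i inside),
        -- so X_i would have no member at all, and x_i x_j at most one neighbour in S.
        members≥2k : ∀ i → 2 * k ≤ members i
        members≥2k i with 2 * k ≤? members i
        ... | yes p = p
        ... | no ¬p with neighbour i
        ...   | j , e = ⊥-elim (2k≰1 (≤-trans (m≤m+n _ _) (≤-trans (balance e)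
                  (≤-trans (≤-reflexive (cong (_+ 𝟙 (member j i)) empty)) (𝟙≤1 (member j i))))))
          where
          outside : ∀ j → Edge G i j → 𝟙 (member i j) ≡ 0
          outside j e = n≤0⇒n≡0 (+-cancelˡ-≤ (2 * k) _ _ (begin
            2 * k + 𝟙 (member i j)         ≤⟨ balance e ⟩
            members i + 𝟙 (member j i)     ≤⟨ +-monoʳ-≤ (members i) (𝟙≤1 (member j i)) ⟩
            members i + 1                  ≡⟨ +-comm (members i) 1 ⟩
            suc (members i)                ≤⟨ ≰⇒> ¬p ⟩
            2 * k                          ≡⟨ +-identityʳ (2 * k) ⟨
            2 * k + 0                      ∎))
            where open ≤-Reasoning
          empty : members i ≡ 0
          empty = trans (∑-cong (allFin n) (λ j → 𝟙-member i j (outside j))) (∑-zero (allFin n))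

        ∑2k : ∑ (allFin n) (λ _ → 2 * k) ≡ 2 * k * n
        ∑2k = trans (∑-allFin-const n (2 * k)) (*-comm n (2 * k))

        Icard≥ : 2 * k * n ≤ Icard G S
        Icard≥ = subst₂ _≤_ ∑2k (sym Icard≡) (∑-mono (allFin n) members≥2k)

        module _ (minimum : Icard G S ≡ 2 * k * n) where

          -- Every clique has at least 2k members and the total is n times 2k, so no clique can
          -- exceed the bound.
          members≡2k : ∀ i → members i ≡ 2 * k
          members≡2k i = sym (∑-tight (allFin n) members≥2k
            (≤-reflexive (trans (sym Icard≡) (trans minimum (sym ∑2k)))) (∈-allFin i))

          member-≤ : ∀ {i j} → Edge G i j → 𝟙 (member i j) ≤ 𝟙 (member j i)
          member-≤ {i} {j} e = +-cancelˡ-≤ (2 * k) _ _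
            (subst (λ m → 2 * k + 𝟙 (member i j) ≤ m + 𝟙 (member j i)) (members≡2k i) (balance e))

          member⇒Edge : ∀ {i j} → member i j ≡ true → Edge G i j
          member⇒Edge {i} {j} p with Graph.adj G i j
          ... | true = refl

          member-mono : ∀ i j → member i j ≡ true → member j i ≡ true
          member-mono i j p with member j i | member-≤ (member⇒Edge p)
          ... | true  | _ = refl
          ... | false | q = ⊥-elim (n≮0 (subst (λ b → 𝟙 b ≤ 0) p q))

          member-sym : ∀ i j → member i j ≡ member j i
          member-sym i j with member i j in p | member j i in q
          ... | true  | true  = refl
          ... | false | false = refl
          ... | true  | false = trans (sym (member-mono i j p)) q
          ... | false | true  = trans (sym p) (member-mono j i q)

theorem2p4 : ∀ {n : ℕ} (G : Graph n) (k : ℕ) →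
    1 ≤ 2 * k → (∀ (v : Fin n) → 2 * k ≤ degree G v) →
    (γ×t-Inflated≡ G (2 * k) (2 * k * n) ⇔ kHLD G k)
theorem2p4 {n} G k k≥1 δ≥2k = mk⇔ to from
  where
  to : γ×t-Inflated≡ G (2 * k) (2 * k * n) → kHLD G k
  -- The regular subgraph is `member G S` and not `S`, whose values on non-adjacent pairs are
  -- arbitrary.
  to ((S , dominating , minimum) , _) = petersen G k (member G S)
    (member-sym G S k k≥1 δ≥2k dominating minimum)
    (λ u v → ∧-conicalˡ (Graph.adj G u v) _)
    (members≡2k G S k k≥1 δ≥2k dominating minimum)
  from : kHLD G k → γ×t-Inflated≡ G (2 * k) (2 * k * n)
  from decomposition with kHLD⇒regular G k decomposition
  ... | T , T-sym , T⊆G , rows = (T , dominating , cardinality) , λ S dom → Icard≥ G S k k≥1 δ≥2k dom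
    where
    member≡T : ∀ u v → member G T u v ≡ T u v
    member≡T u v with T u v in eq
    ... | true  = cong (_∧ true) (T⊆G u v eq)
    ... | false = ∧-zeroʳ (Graph.adj G u v)
    members≡ : ∀ u → members G T u ≡ 2 * k
    members≡ u = trans (∑-cong (allFin n) (cong 𝟙 ∘ member≡T u)) (rows u)
    -- Symmetry of `T` makes the two correction terms of `Inbrs-balance` equal; they cancel, and
    -- every vertex has exactly 2k neighbours in `T`.
    dominating : IsKTupleTDS-I G (2 * k) T
    dominating i j e = ≤-reflexive (sym (+-cancelʳ-≡ (𝟙 (T i j)) _ _ (begin
      Inbrs G T i j + 𝟙 (T i j)                ≡⟨ cong (λ b → Inbrs G T i j + 𝟙 b) (member≡T i j) ⟨
      Inbrs G T i j + 𝟙 (member G T i j)       ≡⟨ Inbrs-balance G T e ⟩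
      members G T i + 𝟙 (member G T j i)       ≡⟨ cong₂ (λ m b → m + 𝟙 b) (members≡ i) (trans (member≡T j i) (T-sym j i)) ⟩
      2 * k + 𝟙 (T i j)                        ∎)))
      where open ≡-Reasoning
    cardinality : Icard G T ≡ 2 * k * n
    cardinality = trans (Icard≡ G T) (trans (∑-cong (allFin n) members≡)
      (trans (∑-allFin-const n (2 * k)) (*-comm n (2 * k))))
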